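{- Consider the following two-player game on the board $\mathbb{Z}^{2}$, with a real parameter $\sigma>0$. The devil controls a weight function (measure) $\mu_t$ on $\mathbb{Z}^2$, with $\mu_0=0$; at each of his turns he may add nonnegative weight to squares, arbitrarily distributed, subject to $\mu_{t+1}\ge \mu_t$ and $\mu_{t+1}(\mathbb{Z}^{2})\le\mu_{t}(\mathbb{Z}^{2})+\sigma$. The angel occupies a square of $\mathbb{Z}^2$; the players alternate turns, and on each of her turns the angel makes at most one step, horizontal or vertical (to an adjacent square). The angel is not allowed to step on a square whose weight is $\ge 1$. Then for all sufficiently small $\sigma>0$, the angel has a strategy in which she will never run out of places to land on, i.e. whatever the devil does, she can continue moving forever without ever stepping on a square of weight $\ge 1$.
   Context: For a set $S\subseteq\mathbb{Z}^2$, $\mu_t(S)$ denotes the total weight of $S$ at time $t$. This weighted game is a strengthening (for the devil) of the classical angel–devil game in which the angel can fly distance $J$ and the devil blackens one square per turn, with $\sigma=1/J$.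
   Formalization: The parameter σ and the weights that the devil places on the squares are rational numbers here instead of real numbers. -}

module Defs where

open import Data.Nat as ℕ using (ℕ; suc)
open import Data.Integer as ℤ using (ℤ; +_; ∣_∣)
open import Data.Rational as ℚ using (ℚ; 0ℚ; 1ℚ)
open import Data.Product using (_×_; _,_; Σ; proj₁; proj₂)
open import Relation.Binary.PropositionalEquality using (_≡_)
open import Data.List using (List; []; _∷_; map; upTo; foldr; concatMap)

Pos : Set
Pos = ℤ × ℤ

origin : Pos
origin = (+ 0 , + 0)

Weight : Set
Weight = Pos → ℚ

-- The ℓ¹-distance of two squares; "at most one horizontal or vertical step"
-- means distance ≤ 1 (distance 0 = staying put).
dist : Pos → Pos → ℕ
dist (x , y) (x' , y') = ∣ x ℤ.- x' ∣ ℕ.+ ∣ y ℤ.- y' ∣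

range : ℕ → List ℤ
range N = map (λ i → (+ i) ℤ.- (+ N)) (upTo (suc (2 ℕ.* N)))

box : ℕ → List Pos
box N = concatMap (λ x → map (λ y → (x , y)) (range N)) (range N)

boxSum : Weight → ℕ → ℚ
boxSum f N = foldr ℚ._+_ 0ℚ (map f (box N))

-- A legal play of the devil with parameter σ: μ : ℕ → Weight with μ₀ = 0,
-- μ_{t+1} ≥ μ_t pointwise, and μ_{t+1}(ℤ²) ≤ μ_t(ℤ²) + σ.  Since the
-- increment μ_{t+1} - μ_t is nonnegative and all totals are finite, the last
-- condition is equivalent to: the increment has total weight ≤ σ, i.e. its
-- sum over every box [-N,N]² is ≤ σ (total = supremum of box sums).
record DevilPlay (σ : ℚ) (μ : ℕ → Weight) : Set where
  field
    start    : ∀ p → μ 0 p ≡ 0ℚ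
    monotone : ∀ t p → μ t p ℚ.≤ μ (suc t) p
    budget   : ∀ t N → boxSum (λ p → μ (suc t) p ℚ.- μ t p) N ℚ.≤ σ

-- An angel strategy: a (deterministic) rule giving the angel's square after
-- the devil has played μ₁, …, μₙ (listed in this order).
AngelStrategy : Set
AngelStrategy = List Weight → Pos

history : (ℕ → Weight) → ℕ → List Weight
history μ n = map (λ i → μ (suc i)) (upTo n)

position : AngelStrategy → (ℕ → Weight) → ℕ → Pos
position A μ n = A (history μ n)

Wins : AngelStrategy → (ℕ → Weight) → Set
Wins A μ =
  (position A μ 0 ≡ origin) ×
  (∀ n → (dist (position A μ n) (position A μ (suc n)) ℕ.≤ 1) ×
         (μ (suc n) (position A μ (suc n)) ℚ.< 1ℚ))

{-# OPTIONS --safe #-}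
module Submission where

-- A potential argument on a hexagonal board whose cells are bricks of two squares.  The angel keeps a set F of
-- cells that contains two infinite walls and maximizes (scaled weight) − (perimeter) among the sets avoiding the
-- cells she has visited, and she walks along the boundary of F.  An unvisited cell off F is light, because adding
-- it to F would cost at most its perimeter 6.  If the walk returns to a cell after n steps, the stretch walked
-- in between encloses a pocket, and filling the pocket removes about n edges from the perimeter.  At the time of
-- the first visit this filling was no improvement, so n is at most a constant plus (n times the small weight
-- added per turn); hence n is bounded and the cell is still light.  The pocket is found without any Jordan curve
-- theorem, as the set of cells of odd winding number of a closed mod 2 chain.

-- Only three cells meet at a corner of a hexagonal tiling, so the boundary of a set of cells never
-- branches and following it is deterministic in both directions (`next-injective`). Regions only
-- grow and never absorb a visited cell, so the whole past of the walk also follows the boundary of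
-- the current region (`e-next`); this lets a pocket found now be judged by the optimality of an
-- earlier time. The obstacle is that the filled region must have been admissible then: it has to
-- avoid the cells visited by that time and to lie in the finite box searched at that time. The
-- former holds because the cells on the left of the walk are linked inside F back to the wall,
-- where the winding number is 0; the latter because cutting a region down to a box costs no
-- perimeter. The search needs a finite box while the devil may use the whole board, so distant
-- weight is faded in, which at most triples the rate of growth. With weights scaled by 24, a cell
-- about to be entered carries at most 7, less than half a unit; the other half absorbs what is
-- added during the two turns that a step takes.

open import Defs
open import Data.Bool using (Bool; true; false; T; _∧_; _∨_; _xor_; not; if_then_else_)
open import Data.Bool.Properties using (∨-zeroʳ; ∧-identityʳ; ∧-zeroʳ; xor-identityʳ; xor-same)
import Data.Bool.Solver as BoolSolver
open import Data.Empty using (⊥-elim)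
open import Data.Integer as ℤ using (_⊖_) renaming (+_ to ⁺_)
import Data.Integer.Properties as ℤₚ
import Data.Integer.Solver as ℤSolver
open import Data.List using (List; []; _∷_; _++_; map; foldr; length; filter; upTo; applyUpTo; cartesianProduct)
import Data.List.Membership.DecPropositional as DecMembership
open import Data.List.Membership.Propositional using (_∈_; _∉_)
open import Data.List.Membership.Propositional.Properties
  using (∈-∃++; ∈-++⁻; ∈-map⁺; ∈-map⁻; ∈-filter⁺; ∈-filter⁻; ∈-upTo⁺; ∈-upTo⁻; ∈-concatMap⁺; ∈-cartesianProduct⁺; ∈-cartesianProduct⁻)
open import Data.List.Properties using (length-map; length-upTo)
open import Data.List.Relation.Binary.Permutation.Propositional as Perm using (_↭_; ↭-sym)
import Data.List.Relation.Binary.Permutation.Propositional.Properties as Permₚ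
import Data.List.Relation.Binary.Permutation.Setoid.Properties as PermSetoidₚ
open import Data.List.Relation.Unary.All as All using ([]; _∷_)
open import Data.List.Relation.Unary.AllPairs as AllPairs using ([]; _∷_)
open import Data.List.Relation.Unary.Any using (Any; here; there)
open import Data.List.Relation.Unary.Unique.Propositional using (Unique)
import Data.List.Relation.Unary.Unique.Propositional.Properties as Uniqueₚ
open import Data.Nat as ℕ using (ℕ; zero; suc; pred; z≤n; s≤s; _≡ᵇ_; _≤ᵇ_)
import Data.Nat.Properties as ℕₚ
open import Data.Nat.Tactic.RingSolver using (solve-∀)
open import Data.Product using (Σ; ∃; _×_; _,_; proj₁; proj₂)
open import Data.Product.Properties using (≡-dec)
open import Data.Rational
  using (ℚ; 0ℚ; ½; 1ℚ; _+_; _*_; -_; _-_; 1/_; _≤_; _<_; _≤?_; _<?_; Positive; positive; nonNegative)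
open import Data.Rational.Properties
open import Data.Rational.Solver using (module +-*-Solver)
open import Data.Sum using (_⊎_; inj₁; inj₂)
open import Relation.Binary.PropositionalEquality
open import Relation.Nullary using (¬_; yes; no)
open import Relation.Nullary.Decidable using (True; toWitness; ¬?; from-yes; from-no)
open +-*-Solver using (solve; _:=_; _:+_; _:*_; _:-_; :-_; con)
open BoolSolver.xor-∧-Solver using () renaming (solve to solveᵇ; _:=_ to _⊜_; _:+_ to _⊕_)
open DecMembership (≡-dec ℕ._≟_ ℕ._≟_) using (_∈?_)

-- Every linear inequality below is obtained by adding up known ones (L ≤ R) and comparing differences.
combine : ∀ {L R p q} → L ≤ R → R + p ≡ L + q → p ≤ q
combine {L} {R} {p} {q} L≤R eq = begin
  p               ≡⟨ solve 2 (λ r x → x := (:- r) :+ (r :+ x)) refl R p ⟩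
  (- R) + (R + p) ≡⟨ cong ((- R) +_) eq ⟩
  (- R) + (L + q) ≤⟨ +-monoʳ-≤ (- R) (+-monoˡ-≤ q L≤R) ⟩
  (- R) + (R + q) ≡⟨ sym (solve 2 (λ r x → x := (:- r) :+ (r :+ x)) refl R q) ⟩
  q               ∎
  where open ≤-Reasoning

*-mono-nonNeg : ∀ {p q} r → 0ℚ ≤ r → p ≤ q → p * r ≤ q * r
*-mono-nonNeg r 0≤r = *-monoʳ-≤-nonNeg r {{nonNegative 0≤r}}

*-nonNeg : ∀ {p q} → 0ℚ ≤ p → 0ℚ ≤ q → 0ℚ ≤ p * q
*-nonNeg {p} {q} 0≤p 0≤q = subst (_≤ p * q) (*-zeroˡ q) (*-mono-nonNeg q 0≤q 0≤p)

0≤-diff : ∀ {p q} → p ≤ q → 0ℚ ≤ q - p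
0≤-diff {p} {q} p≤q = combine p≤q (solve 2 (λ p q → q :+ con 0ℚ := p :+ (q :- p)) refl p q)

ind : Bool → ℚ
ind true  = 1ℚ
ind false = 0ℚ

decide-≤ : ∀ {p q} {_ : True (p ≤? q)} → p ≤ q
decide-≤ {_} {_} {p≤q} = toWitness p≤q

0≤1 : 0ℚ ≤ 1ℚ
0≤1 = decide-≤

0≤ind : ∀ b → 0ℚ ≤ ind b
0≤ind true  = 0≤1
0≤ind false = ≤-refl

ind≤1 : ∀ b → ind b ≤ 1ℚ
ind≤1 true  = ≤-refl
ind≤1 false = 0≤1

fromℕ : ℕ → ℚ
fromℕ zero    = 0ℚ
fromℕ (suc n) = 1ℚ + fromℕ n

0≤fromℕ : ∀ n → 0ℚ ≤ fromℕ n
0≤fromℕ zero    = ≤-refl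
0≤fromℕ (suc n) = +-mono-≤ 0≤1 (0≤fromℕ n)

fromℕ-+ : ∀ m n → fromℕ (m ℕ.+ n) ≡ fromℕ m + fromℕ n
fromℕ-+ zero    n = sym (+-identityˡ _)
fromℕ-+ (suc m) n = trans (cong (1ℚ +_) (fromℕ-+ m n)) (sym (+-assoc 1ℚ (fromℕ m) (fromℕ n)))

fromℕ-mono : ∀ {m n} → m ℕ.≤ n → fromℕ m ≤ fromℕ n
fromℕ-mono {n = n} z≤n = 0≤fromℕ n
fromℕ-mono (s≤s m≤n)   = +-monoʳ-≤ 1ℚ (fromℕ-mono m≤n)

-- Finite sums of rationals

∑ : ∀ {A : Set} → List A → (A → ℚ) → ℚ
∑ xs f = foldr _+_ 0ℚ (map f xs)

module _ {A : Set} where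

  ∑-cong : ∀ (xs : List A) {f g : A → ℚ} → (∀ {x} → x ∈ xs → f x ≡ g x) → ∑ xs f ≡ ∑ xs g
  ∑-cong []       eq = refl
  ∑-cong (x ∷ xs) eq = cong₂ _+_ (eq (here refl)) (∑-cong xs (λ z → eq (there z)))

  ∑-mono : ∀ (xs : List A) {f g : A → ℚ} → (∀ x → f x ≤ g x) → ∑ xs f ≤ ∑ xs g
  ∑-mono []       le = ≤-refl
  ∑-mono (x ∷ xs) le = +-mono-≤ (le x) (∑-mono xs le)

  ∑-nonNeg : ∀ (xs : List A) {f : A → ℚ} → (∀ x → 0ℚ ≤ f x) → 0ℚ ≤ ∑ xs f
  ∑-nonNeg []       le = ≤-refl
  ∑-nonNeg (x ∷ xs) le = +-mono-≤ (le x) (∑-nonNeg xs le)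

  ∑-+ : ∀ (xs : List A) (f g : A → ℚ) → ∑ xs (λ x → f x + g x) ≡ ∑ xs f + ∑ xs g
  ∑-+ []       f g = refl
  ∑-+ (x ∷ xs) f g rewrite ∑-+ xs f g =
    solve 4 (λ a b c d → (a :+ b) :+ (c :+ d) := (a :+ c) :+ (b :+ d)) refl (f x) (g x) (∑ xs f) (∑ xs g)

  ∑-- : ∀ (xs : List A) (f g : A → ℚ) → ∑ xs (λ x → f x - g x) ≡ ∑ xs f - ∑ xs g
  ∑-- []       f g = refl
  ∑-- (x ∷ xs) f g rewrite ∑-- xs f g =
    solve 4 (λ a b c d → (a :- b) :+ (c :- d) := (a :+ c) :- (b :+ d)) refl (f x) (g x) (∑ xs f) (∑ xs g)

  ∑-*ʳ : ∀ (xs : List A) (f : A → ℚ) k → ∑ xs (λ x → f x * k) ≡ ∑ xs f * k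
  ∑-*ʳ []       f k = sym (*-zeroˡ k)
  ∑-*ʳ (x ∷ xs) f k rewrite ∑-*ʳ xs f k = sym (*-distribʳ-+ k (f x) (∑ xs f))

  ∑-++ : ∀ (xs ys : List A) (f : A → ℚ) → ∑ (xs ++ ys) f ≡ ∑ xs f + ∑ ys f
  ∑-++ []       ys f = sym (+-identityˡ _)
  ∑-++ (x ∷ xs) ys f rewrite ∑-++ xs ys f = sym (+-assoc (f x) (∑ xs f) (∑ ys f))

  ∑-zero : ∀ (xs : List A) {f : A → ℚ} → (∀ {x} → x ∈ xs → f x ≡ 0ℚ) → ∑ xs f ≡ 0ℚ
  ∑-zero []       eq = refl
  ∑-zero (x ∷ xs) eq = cong₂ _+_ (eq (here refl)) (∑-zero xs (λ z → eq (there z)))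

  ∑-const : ∀ (xs : List A) {f : A → ℚ} → (∀ {x} → x ∈ xs → f x ≡ 1ℚ) → ∑ xs f ≡ fromℕ (length xs)
  ∑-const []       eq = refl
  ∑-const (x ∷ xs) eq = cong₂ _+_ (eq (here refl)) (∑-const xs (λ z → eq (there z)))

  ∑-map : ∀ {B : Set} (xs : List B) (h : B → A) (f : A → ℚ) → ∑ (map h xs) f ≡ ∑ xs (λ x → f (h x))
  ∑-map []       h f = refl
  ∑-map (x ∷ xs) h f = cong (f (h x) +_) (∑-map xs h f)

  ∑-↭ : ∀ {xs ys : List A} (f : A → ℚ) → xs ↭ ys → ∑ xs f ≡ ∑ ys f
  ∑-↭ f Perm.refl         = refl
  ∑-↭ f (Perm.prep x p)        = cong (f x +_) (∑-↭ f p)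
  ∑-↭ f (Perm.swap x y p) rewrite ∑-↭ f p =
    solve 3 (λ a b c → a :+ (b :+ c) := b :+ (a :+ c)) refl (f x) (f y) _
  ∑-↭ f (Perm.trans p q)  = trans (∑-↭ f p) (∑-↭ f q)

  extract : ∀ {x : A} {ys} → x ∈ ys → ∃ λ zs → ys ↭ x ∷ zs
  extract x∈ys with ∈-∃++ x∈ys
  ... | as , bs , refl = as ++ bs , Permₚ.shift _ as bs

  -- Since `xs` has no repetitions, each of its nonzero entries uses up its own copy in `ys`; what
  -- is left of `ys` is nonnegative, so `ys` may repeat.
  ∑-embed : ∀ {xs ys : List A} {f : A → ℚ} → Unique xs → (∀ x → 0ℚ ≤ f x) →
            (∀ {x} → x ∈ xs → x ∈ ys ⊎ f x ≡ 0ℚ) → ∑ xs f ≤ ∑ ys f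
  ∑-embed {[]} {ys} _ 0≤f _ = ∑-nonNeg ys 0≤f
  ∑-embed {x ∷ xs} {ys} {f} u@(_ ∷ uxs) 0≤f sub with sub (here refl)
  ... | inj₂ fx≡0 = ≤-trans (≤-reflexive (trans (cong (_+ ∑ xs f) fx≡0) (+-identityˡ _)))
                            (∑-embed uxs 0≤f (λ z → sub (there z)))
  ... | inj₁ x∈ys with extract x∈ys
  ...   | zs , ys↭ = ≤-trans (+-monoʳ-≤ (f x) (∑-embed uxs 0≤f rest)) (≤-reflexive (sym (∑-↭ f ys↭)))
    where
    rest : ∀ {z} → z ∈ xs → z ∈ zs ⊎ f z ≡ 0ℚ
    rest z∈xs with sub (there z∈xs)
    ... | inj₂ eq   = inj₂ eq
    ... | inj₁ z∈ys with Permₚ.∈-resp-↭ ys↭ z∈ys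
    ...   | here refl = ⊥-elim (Uniqueₚ.Unique[x∷xs]⇒x∉xs u z∈xs)
    ...   | there z∈  = inj₁ z∈

  ∑-support : ∀ {xs ys : List A} {f : A → ℚ} → Unique xs → Unique ys → (∀ {x} → x ∈ xs → x ∈ ys) →
              (∀ {x} → x ∈ ys → x ∈ xs ⊎ f x ≡ 0ℚ) → ∑ xs f ≡ ∑ ys f
  ∑-support {[]} {ys} _ _ _ vanish = sym (∑-zero ys λ z → case (vanish z))
    where
    case : ∀ {z : A} {b : Set} → z ∈ [] ⊎ b → b
    case (inj₂ b) = b
  ∑-support {x ∷ xs} {ys} {f} u@(_ ∷ uxs) uys sub vanish with extract (sub (here refl))
  ... | zs , ys↭ = trans (cong (f x +_) (∑-support uxs (AllPairs.tail uzs) sub′ vanish′)) (sym (∑-↭ f ys↭))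
    where
    uzs : Unique (x ∷ zs)
    uzs = PermSetoidₚ.Unique-resp-↭ (setoid A) (Perm.↭⇒↭ₛ ys↭) uys
    sub′ : ∀ {z} → z ∈ xs → z ∈ zs
    sub′ z∈xs with Permₚ.∈-resp-↭ ys↭ (sub (there z∈xs))
    ... | here refl = ⊥-elim (Uniqueₚ.Unique[x∷xs]⇒x∉xs u z∈xs)
    ... | there z∈  = z∈
    vanish′ : ∀ {z} → z ∈ zs → z ∈ xs ⊎ f z ≡ 0ℚ
    vanish′ z∈zs with vanish (Permₚ.∈-resp-↭ (↭-sym ys↭) (there z∈zs))
    ... | inj₂ eq         = inj₂ eq
    ... | inj₁ (here refl) = ⊥-elim (Uniqueₚ.Unique[x∷xs]⇒x∉xs uzs z∈zs)
    ... | inj₁ (there z∈) = inj₁ z∈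

-- Hexagonal adjacency: cells, sides and directed edges

Cell : Set
Cell = ℕ × ℕ

-- `nb` uses `pred`, so west, southwest and south are genuine neighbours only away from the axes.
-- Matching on this predicate lets the geometric facts below hold by `refl`.
data Interior : Cell → Set where
  interior : ∀ {x y} → Interior (suc x , suc y)

data Dir : Set where
  east northeast north west southwest south : Dir

cw : Dir → Dir
cw east  = south
cw northeast = east
cw north  = northeast
cw west  = north
cw southwest = west
cw south  = southwest

ccw : Dir → Dir
ccw east  = northeast
ccw northeast = north
ccw north  = west
ccw west  = southwest
ccw southwest = south
ccw south  = east

nb : Dir → Cell → Cell
nb east  (x , y) = suc x , y
nb northeast (x , y) = suc x , suc y
nb north  (x , y) = x , suc y
nb west  (x , y) = pred x , y
nb southwest (x , y) = pred x , pred y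
nb south  (x , y) = x , pred y

data Kind : Set where
  h v g : Kind

Side : Set
Side = Kind × Cell

lo hi : Side → Cell
lo (_ , c) = c
hi (h , c) = nb east c
hi (v , c) = nb north c
hi (g , c) = nb northeast c

-- (r , d) is the side between r and nb d r, traversed with nb d r on the left.
Edge : Set
Edge = Cell × Dir

right left : Edge → Cell
right (r , _) = r
left (r , d) = nb d r

side : Edge → Side
side (r , east)  = h , r
side (r , northeast) = g , r
side (r , north)  = v , r
side (r , west)  = h , nb west r
side (r , southwest) = g , nb southwest r
side (r , south)  = v , nb south r

data Half : Set where
  lower upper : Half

-- lower (x , y) has the corners (x , y), (x+1 , y), (x+1 , y+1), and
-- upper (x , y) has the corners (x , y), (x , y+1), (x+1 , y+1).
Triangle : Set
Triangle = Half × Cell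

tail : Edge → Triangle
tail (r , east)  = lower , r
tail (r , northeast) = upper , r
tail (r , north)  = lower , nb west r
tail (r , west)  = upper , nb southwest r
tail (r , southwest) = lower , nb southwest r
tail (r , south)  = upper , nb south r

-- Three cells meet at the head: `r`, `nb d r` and `nb (cw d) r`. Taking the tail of the clockwise
-- turn as the head makes a sequence of turns around one cell a path by definition.
head : Edge → Triangle
head (r , d) = tail (r , cw d)

ends : ∀ e → Interior (right e) → (lo (side e) ≡ right e × hi (side e) ≡ left e) ⊎ (lo (side e) ≡ left e × hi (side e) ≡ right e)
ends (_ , east)  interior = inj₁ (refl , refl)
ends (_ , northeast) interior = inj₁ (refl , refl)
ends (_ , north)  interior = inj₁ (refl , refl)
ends (_ , west)  interior = inj₂ (refl , refl)
ends (_ , southwest) interior = inj₂ (refl , refl)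
ends (_ , south)  interior = inj₂ (refl , refl)

-- A side carries two edges, one for each direction of traversal; the second alternative is the
-- reversed edge.
side-injective : ∀ {e f} → Interior (right e) → Interior (right f) → side e ≡ side f → e ≡ f ⊎ right f ≡ left e
side-injective {_ , east}  {_ , east}  interior interior refl = inj₁ refl
side-injective {_ , east}  {_ , west}  interior interior refl = inj₂ refl
side-injective {_ , northeast} {_ , northeast} interior interior refl = inj₁ refl
side-injective {_ , northeast} {_ , southwest} interior interior refl = inj₂ refl
side-injective {_ , north}  {_ , north}  interior interior refl = inj₁ refl
side-injective {_ , north}  {_ , south}  interior interior refl = inj₂ refl
side-injective {_ , west}  {_ , east}  interior interior refl = inj₂ refl
side-injective {_ , west}  {_ , west}  interior interior refl = inj₁ refl
side-injective {_ , southwest} {_ , northeast} interior interior refl = inj₂ refl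
side-injective {_ , southwest} {_ , southwest} interior interior refl = inj₁ refl
side-injective {_ , south}  {_ , north}  interior interior refl = inj₂ refl
side-injective {_ , south}  {_ , south}  interior interior refl = inj₁ refl

-- The two ways on past the head: `step` keeps the left cell and enters the third cell, `turn` keeps
-- the right cell and makes the third cell the new left one.
step : Edge → Edge
step (r , d) = nb (cw d) r , ccw d

turn : Edge → Edge
turn (r , d) = r , cw d

head-step : ∀ e → Interior (right e) → head e ≡ tail (step e)
head-step (_ , east)  interior = refl
head-step (_ , northeast) interior = refl
head-step (_ , north)  interior = refl
head-step (_ , west)  interior = refl
head-step (_ , southwest) interior = refl
head-step (_ , south)  interior = refl

left-step : ∀ e → Interior (right e) → left (step e) ≡ left e
left-step (_ , east)  interior = refl
left-step (_ , northeast) interior = refl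
left-step (_ , north)  interior = refl
left-step (_ , west)  interior = refl
left-step (_ , southwest) interior = refl
left-step (_ , south)  interior = refl

-- When the walk turns, its left cell changes to an adjacent one. The side between the two is what
-- shows that the left cells all lie on the same side of a loop.
left-left : ∀ e → Interior (right e) →
            ∃ λ u → (lo u ≡ left e × hi u ≡ left (turn e)) ⊎ (lo u ≡ left (turn e) × hi u ≡ left e)
left-left (_ , east)  (interior {x} {y}) = (g , suc x , y) , inj₂ (refl , refl)
left-left (_ , northeast) (interior {x} {y}) = (v , suc (suc x) , suc y) , inj₂ (refl , refl)
left-left (_ , north)  (interior {x} {y}) = (h , suc x , suc (suc y)) , inj₁ (refl , refl)
left-left (_ , west)  (interior {x} {y}) = (g , x , suc y) , inj₁ (refl , refl)
left-left (_ , southwest) (interior {x} {y}) = (v , x , y) , inj₁ (refl , refl)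
left-left (_ , south)  (interior {x} {y}) = (h , x , y) , inj₂ (refl , refl)

turns : Dir → ℕ → Dir
turns d zero    = d
turns d (suc n) = cw (turns d n)

-- Passing through `east` replaces 36 cases by 12.
turns-reach : ∀ d d′ → ∃ λ n → turns d n ≡ d′
turns-reach d d′ with toEast d | fromEast d′
  where
  toEast : ∀ d → ∃ λ n → turns d n ≡ east
  toEast east      = 0 , refl
  toEast northeast = 1 , refl
  toEast north     = 2 , refl
  toEast west      = 3 , refl
  toEast southwest = 4 , refl
  toEast south     = 5 , refl
  fromEast : ∀ d → ∃ λ n → turns east n ≡ d
  fromEast east      = 0 , refl
  fromEast south     = 1 , refl
  fromEast southwest = 2 , refl
  fromEast west      = 3 , refl
  fromEast north     = 4 , refl
  fromEast northeast = 5 , refl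
... | m , eq | n , eq′ = n ℕ.+ m , trans (turns-+ n) (trans (cong (λ c → turns c n) eq) eq′)
  where
  turns-+ : ∀ n → turns d (n ℕ.+ m) ≡ turns (turns d m) n
  turns-+ zero    = refl
  turns-+ (suc n) = cong cw (turns-+ n)

side-interior : ∀ e {y} → Interior (right e) → side e ≢ (v , 0 , y)
side-interior (_ , east)      interior ()
side-interior (_ , northeast) interior ()
side-interior (_ , north)     interior ()
side-interior (_ , west)      interior ()
side-interior (_ , southwest) interior ()
side-interior (_ , south)     interior ()

side-bounded : ∀ e → proj₁ (lo (side e)) ℕ.≤ proj₁ (right e) × proj₂ (lo (side e)) ℕ.≤ proj₂ (right e)
side-bounded (_ , east)      = ℕₚ.≤-refl , ℕₚ.≤-refl
side-bounded (_ , northeast) = ℕₚ.≤-refl , ℕₚ.≤-refl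
side-bounded (_ , north)     = ℕₚ.≤-refl , ℕₚ.≤-refl
side-bounded (_ , west)      = ℕₚ.pred[n]≤n , ℕₚ.≤-refl
side-bounded (_ , southwest) = ℕₚ.pred[n]≤n , ℕₚ.pred[n]≤n
side-bounded (_ , south)     = ℕₚ.≤-refl , ℕₚ.pred[n]≤n

-- Boolean equality, so that (suc x ≡ᵇ suc y) and (x ≡ᵇ y) agree definitionally.
sameCell : Cell → Cell → Bool
sameCell (x , y) (x′ , y′) = (x ≡ᵇ x′) ∧ (y ≡ᵇ y′)

same : Side → Side → Bool
same (h , c) (h , c′) = sameCell c c′
same (v , c) (v , c′) = sameCell c c′
same (g , c) (g , c′) = sameCell c c′
same _       _        = false

sameTriangle : Triangle → Triangle → Bool
sameTriangle (lower , c) (lower , c′) = sameCell c c′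
sameTriangle (upper , c) (upper , c′) = sameCell c c′
sameTriangle _           _            = false

≡ᵇ-refl : ∀ n → (n ≡ᵇ n) ≡ true
≡ᵇ-refl zero    = refl
≡ᵇ-refl (suc n) = ≡ᵇ-refl n

≡ᵇ-≡ : ∀ {m n} → (m ≡ᵇ n) ≡ true → m ≡ n
≡ᵇ-≡ {zero}  {zero}  _  = refl
≡ᵇ-≡ {suc m} {suc n} eq = cong suc (≡ᵇ-≡ eq)

sameCell-refl : ∀ c → sameCell c c ≡ true
sameCell-refl (x , y) rewrite ≡ᵇ-refl x | ≡ᵇ-refl y = refl

sameCell-≡ : ∀ {c c′} → sameCell c c′ ≡ true → c ≡ c′
sameCell-≡ {x , y} {x′ , y′} eq with x ≡ᵇ x′ in p | y ≡ᵇ y′ in q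
... | true | true = cong₂ _,_ (≡ᵇ-≡ p) (≡ᵇ-≡ q)

same-refl : ∀ u → same u u ≡ true
same-refl (h , c) = sameCell-refl c
same-refl (v , c) = sameCell-refl c
same-refl (g , c) = sameCell-refl c

same-≡ : ∀ {u u′} → same u u′ ≡ true → u ≡ u′
same-≡ {h , _} {h , _} eq = cong (h ,_) (sameCell-≡ eq)
same-≡ {v , _} {v , _} eq = cong (v ,_) (sameCell-≡ eq)
same-≡ {g , _} {g , _} eq = cong (g ,_) (sameCell-≡ eq)

-- Mod 2 chains of sides and their boundary

parity : List Edge → Side → Bool
parity []       u = false
parity (e ∷ es) u = same (side e) u xor parity es u

parity-∉ : ∀ es {u} → (∀ {e} → e ∈ es → side e ≢ u) → parity es u ≡ false
parity-∉ []       avoid = refl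
parity-∉ (e ∷ es) {u} avoid with same (side e) u in eq
... | true  = ⊥-elim (avoid (here refl) (same-≡ eq))
... | false = parity-∉ es (λ z → avoid (there z))

parity-∈ : ∀ es {e} → Unique (map side es) → e ∈ es → parity es (side e) ≡ true
parity-∈ (e ∷ es) (fresh ∷ _) (here refl)
  rewrite same-refl (side e) | parity-∉ es {side e} (λ f∈ eq → All.lookup fresh (∈-map⁺ side f∈) (sym eq)) = refl
parity-∈ (e ∷ es) {f} (fresh ∷ unique) (there f∈) with same (side e) (side f) in eq
... | true  = ⊥-elim (All.lookup fresh (∈-map⁺ side f∈) (same-≡ eq))
... | false = parity-∈ es unique f∈

parity-true : ∀ es {u} → parity es u ≡ true → ∃ λ e → e ∈ es × side e ≡ u
parity-true (e ∷ es) {u} odd with same (side e) u in eq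
... | true  = e , here refl , same-≡ eq
... | false with parity-true es odd
...   | f , f∈ , eq′ = f , there f∈ , eq′

-- Dually, ∂ χ is the mod 2 boundary of the chain χ of edges of the hexagonal grid, whose vertices are the triangles.
∂ : (Side → Bool) → Triangle → Bool
∂ χ (lower , x , y) = χ (h , x , y) xor (χ (v , suc x , y) xor χ (g , x , y))
∂ χ (upper , x , y) = χ (v , x , y) xor (χ (h , x , suc y) xor χ (g , x , y))

∂-xor : ∀ χ χ′ T → ∂ (λ u → χ u xor χ′ u) T ≡ ∂ χ T xor ∂ χ′ T
∂-xor χ χ′ (lower , x , y) =
  solveᵇ 6 (λ a b c a′ b′ c′ → (a ⊕ a′) ⊕ ((b ⊕ b′) ⊕ (c ⊕ c′)) ⊜ (a ⊕ (b ⊕ c)) ⊕ (a′ ⊕ (b′ ⊕ c′))) refl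
    (χ (h , x , y)) (χ (v , suc x , y)) (χ (g , x , y)) (χ′ (h , x , y)) (χ′ (v , suc x , y)) (χ′ (g , x , y))
∂-xor χ χ′ (upper , x , y) =
  solveᵇ 6 (λ a b c a′ b′ c′ → (a ⊕ a′) ⊕ ((b ⊕ b′) ⊕ (c ⊕ c′)) ⊜ (a ⊕ (b ⊕ c)) ⊕ (a′ ⊕ (b′ ⊕ c′))) refl
    (χ (v , x , y)) (χ (h , x , suc y)) (χ (g , x , y)) (χ′ (v , x , y)) (χ′ (h , x , suc y)) (χ′ (g , x , y))

∂-edge : ∀ e → Interior (right e) → ∀ T → ∂ (same (side e)) T ≡ sameTriangle (tail e) T xor sameTriangle (head e) T
∂-edge (_ , east)  interior (lower , _) = refl
∂-edge (_ , east)  interior (upper , _) = xor-identityʳ _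
∂-edge (_ , northeast) interior (lower , _) = refl
∂-edge (_ , northeast) interior (upper , _) = sym (xor-identityʳ _)
∂-edge (_ , north)  interior (lower , _) = refl
∂-edge (_ , north)  interior (upper , _) = xor-identityʳ _
∂-edge (_ , west)  interior (lower , _) = xor-identityʳ _
∂-edge (_ , west)  interior (upper , _) = refl
∂-edge (_ , southwest) interior (lower , _) = sym (xor-identityʳ _)
∂-edge (_ , southwest) interior (upper , _) = refl
∂-edge (_ , south)  interior (lower , _) = xor-identityʳ _
∂-edge (_ , south)  interior (upper , _) = refl

path : (ℕ → Edge) → ℕ → List Edge
path e zero    = []
path e (suc n) = e 0 ∷ path (λ k → e (suc k)) n

∈-path : ∀ e n {f} → f ∈ path e n → ∃ λ k → k ℕ.< n × f ≡ e k
∈-path e (suc n) (here refl) = 0 , s≤s z≤n , refl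
∈-path e (suc n) (there f∈) with ∈-path (λ k → e (suc k)) n f∈
... | k , k<n , eq = suc k , s≤s k<n , eq

path-unique : ∀ e n → (∀ j k → j ℕ.< k → k ℕ.< n → side (e j) ≢ side (e k)) → Unique (map side (path e n))
path-unique e zero    distinct = []
path-unique e (suc n) distinct =
  All.tabulate fresh ∷ path-unique (λ k → e (suc k)) n (λ j k j<k k<n → distinct (suc j) (suc k) (s≤s j<k) (s≤s k<n))
  where
  fresh : ∀ {u} → u ∈ map side (path (λ k → e (suc k)) n) → side (e 0) ≢ u
  fresh u∈ with ∈-map⁻ side u∈
  ... | f , f∈ , refl with ∈-path (λ k → e (suc k)) n f∈
  ...   | k , k<n , refl = distinct 0 (suc k) (s≤s z≤n) (s≤s k<n)

length-path : ∀ e n → length (path e n) ≡ n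
length-path e zero    = refl
length-path e (suc n) = cong suc (length-path (λ k → e (suc k)) n)

-- Consecutive edges share a vertex, which cancels mod 2; the two end vertices remain.
∂-path : ∀ e n → (∀ k → k ℕ.< n → Interior (right (e k)) × head (e k) ≡ tail (e (suc k))) →
         ∀ T → ∂ (parity (path e n)) T ≡ sameTriangle (tail (e 0)) T xor sameTriangle (tail (e n)) T
∂-path e zero    linked T = trans (∂-∅ T) (sym (xor-same (sameTriangle (tail (e 0)) T)))
  where
  ∂-∅ : ∀ T → ∂ (parity []) T ≡ false
  ∂-∅ (lower , _) = refl
  ∂-∅ (upper , _) = refl
∂-path e (suc n) linked T = begin
  ∂ (parity (path e (suc n))) T
    ≡⟨ ∂-xor (same (side (e 0))) (parity (path (λ k → e (suc k)) n)) T ⟩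
  ∂ (same (side (e 0))) T xor ∂ (parity (path (λ k → e (suc k)) n)) T
    ≡⟨ cong₂ _xor_ (∂-edge (e 0) (proj₁ (linked 0 (s≤s z≤n))) T) (∂-path (λ k → e (suc k)) n (λ k k<n → linked (suc k) (s≤s k<n)) T) ⟩
  (sameTriangle (tail (e 0)) T xor sameTriangle (head (e 0)) T) xor (sameTriangle (tail (e 1)) T xor last)
    ≡⟨ cong (λ t → (sameTriangle (tail (e 0)) T xor sameTriangle t T) xor (sameTriangle (tail (e 1)) T xor last)) (proj₂ (linked 0 (s≤s z≤n))) ⟩
  (sameTriangle (tail (e 0)) T xor sameTriangle (tail (e 1)) T) xor (sameTriangle (tail (e 1)) T xor last)
    ≡⟨ solveᵇ 3 (λ a b c → (a ⊕ b) ⊕ (b ⊕ c) ⊜ a ⊕ c) refl (sameTriangle (tail (e 0)) T) (sameTriangle (tail (e 1)) T) last ⟩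
  sameTriangle (tail (e 0)) T xor last ∎
  where
  open ≡-Reasoning
  last : Bool
  last = sameTriangle (tail (e (suc n))) T

-- Winding numbers mod 2

xor-false : ∀ {p q} → p xor q ≡ false → p ≡ q
xor-false {true}  {true}  _ = refl
xor-false {false} {false} _ = refl

-- Mod 2 winding number of a closed chain, counted along the row to the left of a cell.
winding : (Side → Bool) → Cell → Bool
winding χ (zero  , y) = false
winding χ (suc x , y) = winding χ (x , y) xor χ (h , x , y)

-- `winding` is 0 throughout column 0 by definition, which is consistent only if the chain contains
-- no side between two cells of that column; hence the hypothesis `wall`.
module _ (χ : Side → Bool) (closed : ∀ T → ∂ χ T ≡ false) (wall : ∀ y → χ (v , 0 , y) ≡ false) where

  private
    w : Cell → Bool
    w = winding χ

  -- Induction along the row: closedness at the two triangles between column `x` and column `suc x`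
  -- carries the claim from one `v` side to the next.
  winding-v : ∀ x y → w (x , y) xor w (x , suc y) ≡ χ (v , x , y)
  winding-v zero    y = sym (wall y)
  winding-v (suc x) y = begin
    (w (x , y) xor χ (h , x , y)) xor (w (x , suc y) xor χ (h , x , suc y))
      ≡⟨ solveᵇ 4 (λ a b c d → (a ⊕ b) ⊕ (c ⊕ d) ⊜ (a ⊕ c) ⊕ (b ⊕ d)) refl (w (x , y)) (χ (h , x , y)) (w (x , suc y)) (χ (h , x , suc y)) ⟩
    (w (x , y) xor w (x , suc y)) xor (χ (h , x , y) xor χ (h , x , suc y))
      ≡⟨ cong₂ (λ p q → p xor (q xor χ (h , x , suc y))) (trans (winding-v x y) (xor-false (closed (upper , x , y)))) (xor-false {χ (h , x , y)} (closed (lower , x , y))) ⟩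
    (χ (h , x , suc y) xor χ (g , x , y)) xor ((χ (v , suc x , y) xor χ (g , x , y)) xor χ (h , x , suc y))
      ≡⟨ solveᵇ 3 (λ a b c → (a ⊕ b) ⊕ ((c ⊕ b) ⊕ a) ⊜ c) refl (χ (h , x , suc y)) (χ (g , x , y)) (χ (v , suc x , y)) ⟩
    χ (v , suc x , y) ∎
    where open ≡-Reasoning

  winding-side : ∀ u → w (lo u) xor w (hi u) ≡ χ u
  winding-side (h , x , y) = solveᵇ 2 (λ a b → a ⊕ (a ⊕ b) ⊜ b) refl (w (x , y)) (χ (h , x , y))
  winding-side (v , x , y) = winding-v x y
  winding-side (g , x , y) = begin
    w (x , y) xor (w (x , suc y) xor χ (h , x , suc y))
      ≡⟨ solveᵇ 3 (λ a b c → a ⊕ (b ⊕ c) ⊜ (a ⊕ b) ⊕ c) refl (w (x , y)) (w (x , suc y)) (χ (h , x , suc y)) ⟩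
    (w (x , y) xor w (x , suc y)) xor χ (h , x , suc y)
      ≡⟨ cong (_xor χ (h , x , suc y)) (trans (winding-v x y) (xor-false (closed (upper , x , y)))) ⟩
    (χ (h , x , suc y) xor χ (g , x , y)) xor χ (h , x , suc y)
      ≡⟨ solveᵇ 2 (λ a b → (a ⊕ b) ⊕ a ⊜ b) refl (χ (h , x , suc y)) (χ (g , x , y)) ⟩
    χ (g , x , y) ∎
    where open ≡-Reasoning

  module _ {Q} (bounded : ∀ {k x y} → Q ℕ.≤ x ⊎ Q ℕ.≤ y → χ (k , x , y) ≡ false) where

    winding-above : ∀ x {y} → Q ℕ.≤ y → w (x , y) ≡ false
    winding-above zero    Q≤y = refl
    winding-above (suc x) Q≤y rewrite winding-above x Q≤y | bounded {h} {x} (inj₂ Q≤y) = refl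

    -- To the right of the chain, climbing the column crosses no side of it, and above the chain the
    -- winding number is 0.
    winding-beyond : ∀ {x} y → Q ℕ.≤ x → w (x , y) ≡ false
    winding-beyond {x} y Q≤x = trans (climb Q y) (winding-above x (ℕₚ.m≤m+n Q y))
      where
      climb : ∀ k y → w (x , y) ≡ w (x , k ℕ.+ y)
      climb zero    y = refl
      climb (suc k) y = trans (climb k y) (xor-false (trans (winding-v x (k ℕ.+ y)) (bounded (inj₁ Q≤x))))

-- Regions and their score in a finite window

window : ℕ → List Side
window N = cartesianProduct (h ∷ v ∷ g ∷ []) (cartesianProduct (upTo N) (upTo N))

window-unique : ∀ N → Unique (window N)
window-unique N = Uniqueₚ.cartesianProduct⁺ kinds (Uniqueₚ.cartesianProduct⁺ (Uniqueₚ.upTo⁺ N) (Uniqueₚ.upTo⁺ N))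
  where
  kinds : Unique (h ∷ v ∷ g ∷ [])
  kinds = ((λ ()) ∷ (λ ()) ∷ []) ∷ ((λ ()) ∷ []) ∷ [] ∷ []

∈-window : ∀ {N} k {x y} → x ℕ.< N → y ℕ.< N → (k , x , y) ∈ window N
∈-window k x<N y<N = ∈-cartesianProduct⁺ (kind k) (∈-cartesianProduct⁺ (∈-upTo⁺ x<N) (∈-upTo⁺ y<N))
  where
  kind : ∀ k → k ∈ h ∷ v ∷ g ∷ []
  kind h = here refl
  kind v = there (here refl)
  kind g = there (there (here refl))

window-or-far : ∀ N k x y → (k , x , y) ∈ window N ⊎ (N ℕ.≤ x ⊎ N ℕ.≤ y)
window-or-far N k x y with x ℕ.<? N | y ℕ.<? N
... | yes x<N | yes y<N = inj₁ (∈-window k x<N y<N)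
... | no  x≮N | _       = inj₂ (inj₁ (ℕₚ.≮⇒≥ x≮N))
... | yes _   | no  y≮N = inj₂ (inj₂ (ℕₚ.≮⇒≥ y≮N))

∈-window⁻ : ∀ {N k x y} → (k , x , y) ∈ window N → x ℕ.< N × y ℕ.< N
∈-window⁻ {N} u∈ with ∈-cartesianProduct⁻ (h ∷ v ∷ g ∷ []) (cartesianProduct (upTo N) (upTo N)) u∈
... | _ , c∈ with ∈-cartesianProduct⁻ (upTo N) (upTo N) c∈
...   | x∈ , y∈ = ∈-upTo⁻ x∈ , ∈-upTo⁻ y∈

hi-≥ : ∀ u → proj₁ (lo u) ℕ.≤ proj₁ (hi u) × proj₂ (lo u) ℕ.≤ proj₂ (hi u)
hi-≥ (h , x , y) = ℕₚ.n≤1+n x , ℕₚ.≤-refl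
hi-≥ (v , x , y) = ℕₚ.≤-refl , ℕₚ.n≤1+n y
hi-≥ (g , x , y) = ℕₚ.n≤1+n x , ℕₚ.n≤1+n y

Region : Set
Region = Cell → Bool

_⊆ᴿ_ : Region → Region → Set
F ⊆ᴿ G = ∀ {c} → F c ≡ true → G c ≡ true

walls : Region
walls (suc _ , suc _) = false
walls _               = true

inBox : ℕ → Region
inBox M (x , y) = (x ≤ᵇ M) ∧ (y ≤ᵇ M)

keep : ℕ → Region
keep M c = walls c ∨ inBox M c

boundary : Region → Side → Bool
boundary F u = F (lo u) xor F (hi u)

-- Each cell is `lo` of exactly one `h` side, so with weights placed on the `h` sides a single sum
-- over sides gives weight minus perimeter.
value : (Side → ℚ) → Region → Side → ℚ
value W F u = W u * ind (F (lo u)) - ind (boundary F u)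

score : ℕ → (Side → ℚ) → Region → ℚ
score N W F = ∑ (window N) (value W F)

value-cong : ∀ W F G u → F (lo u) ≡ G (lo u) → F (hi u) ≡ G (hi u) → value W F u ≡ value W G u
value-cong W F G u eq eq′ = cong₂ (λ a b → W u * ind a - ind (a xor b)) eq eq′

score-cong : ∀ N W F G → (∀ c → F c ≡ G c) → score N W F ≡ score N W G
score-cong N W F G eq = ∑-cong (window N) (λ {u} _ → value-cong W F G u (eq (lo u)) (eq (hi u)))

score-mono : ∀ N {W W′} F → (∀ u → W u ≤ W′ u) → score N W F ≤ score N W′ F
score-mono N F W≤W′ = ∑-mono (window N) λ u →
  +-monoˡ-≤ (- ind (boundary F u)) (*-mono-nonNeg _ (0≤ind (F (lo u))) (W≤W′ u))

score-increment : ∀ N {W W′} F → (∀ u → W u ≤ W′ u) →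
                  score N W′ F ≤ score N W F + ∑ (window N) (λ u → W′ u - W u)
score-increment N {W} {W′} F W≤W′ =
  ≤-trans (∑-mono (window N) pointwise) (≤-reflexive (∑-+ (window N) (value W F) (λ u → W′ u - W u)))
  where
  pointwise : ∀ u → value W′ F u ≤ value W F u + (W′ u - W u)
  pointwise u with F (lo u)
  ... | true  = ≤-reflexive (solve 3 (λ a b c → b :* con 1ℚ :- c := (a :* con 1ℚ :- c) :+ (b :- a)) refl (W u) (W′ u) _)
  ... | false = combine (W≤W′ u) (solve 3 (λ a b c → b :+ (b :* con 0ℚ :- c) := a :+ ((a :* con 0ℚ :- c) :+ (b :- a))) refl (W u) (W′ u) _)

Confined : ℕ → Region → Set
Confined M F = F ⊆ᴿ keep M

≤ᵇ-false : ∀ {m n} → n ℕ.< m → (m ≤ᵇ n) ≡ false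
≤ᵇ-false {m} {n} n<m with m ≤ᵇ n in eq
... | false = refl
... | true  = ⊥-elim (ℕₚ.<⇒≱ n<m (ℕₚ.≤ᵇ⇒≤ m n (subst T (sym eq) _)))

≤ᵇ-true : ∀ {m n} → m ℕ.≤ n → (m ≤ᵇ n) ≡ true
≤ᵇ-true {m} {n} m≤n with m ≤ᵇ n | ℕₚ.≤⇒≤ᵇ m≤n
... | true | _ = refl

≤ᵇ-sound : ∀ {m n} → (m ≤ᵇ n) ≡ true → m ℕ.≤ n
≤ᵇ-sound {m} {n} eq with m ℕ.≤? n
... | yes m≤n = m≤n
... | no  m≰n with () ← trans (sym eq) (≤ᵇ-false (ℕₚ.≰⇒> m≰n))

inBox-far : ∀ {M x y} → M ℕ.< x ⊎ M ℕ.< y → inBox M (x , y) ≡ false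
inBox-far (inj₁ M<x) rewrite ≤ᵇ-false M<x = refl
inBox-far {M} {x} (inj₂ M<y) rewrite ≤ᵇ-false M<y = ∧-zeroʳ (x ≤ᵇ M)

far : ∀ {M F x y} → walls ⊆ᴿ F → Confined M F → M ℕ.< x ⊎ M ℕ.< y → F (x , y) ≡ walls (x , y)
far {M} {F} {x} {y} walled confined M< with F (x , y) in eq | walls (x , y) in eq′
... | true  | true  = refl
... | false | false = refl
... | false | true  with () ← trans (sym eq) (walled eq′)
... | true  | false with () ← trans (sym (cong₂ _∨_ eq′ (inBox-far M<))) (confined eq)

far-hi : ∀ {M} u → M ℕ.< proj₁ (lo u) ⊎ M ℕ.< proj₂ (lo u) → M ℕ.< proj₁ (hi u) ⊎ M ℕ.< proj₂ (hi u)
far-hi u (inj₁ M<x) = inj₁ (ℕₚ.≤-trans M<x (proj₁ (hi-≥ u)))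
far-hi u (inj₂ M<y) = inj₂ (ℕₚ.≤-trans M<y (proj₂ (hi-≥ u)))

-- The walls have infinite perimeter, so only differences of scores are meaningful. They do not
-- depend on the window: beyond the smaller one both regions coincide with the walls.
score-window : ∀ {M N W F G} → walls ⊆ᴿ F → walls ⊆ᴿ G → Confined M F → Confined M G → suc M ℕ.≤ N →
               score (suc M) W F ≤ score (suc M) W G → score N W F ≤ score N W G
score-window {M} {N} {W} {F} {G} wF wG cF cG M<N le = combine le rearranged
  where
  difference : ∀ L → ∑ (window L) (λ u → value W G u - value W F u) ≡ score L W G - score L W F
  difference L = ∑-- (window L) (value W G) (value W F)
  grow : ∀ {u} → u ∈ window (suc M) → u ∈ window N
  grow {k , x , y} u∈ = ∈-window k (ℕₚ.≤-trans (proj₁ (∈-window⁻ u∈)) M<N) (ℕₚ.≤-trans (proj₂ (∈-window⁻ u∈)) M<N)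
  vanish : ∀ {u} → u ∈ window N → u ∈ window (suc M) ⊎ value W G u - value W F u ≡ 0ℚ
  vanish {u@(k , x , y)} _ with window-or-far (suc M) k x y
  ... | inj₁ u∈ = inj₁ u∈
  ... | inj₂ M< = inj₂ (trans (cong (_- value W F u) (value-cong W G F u
      (trans (far wG cG M<) (sym (far wF cF M<)))
      (trans (far wG cG (far-hi u M<)) (sym (far wF cF (far-hi u M<))))))
      (+-inverseʳ (value W F u)))
  equal : score (suc M) W G - score (suc M) W F ≡ score N W G - score N W F
  equal = trans (sym (difference (suc M))) (trans (∑-support (window-unique (suc M)) (window-unique N) grow vanish) (difference N))
  rearranged : score (suc M) W G + score N W F ≡ score (suc M) W F + score N W G
  rearranged = begin
    score (suc M) W G + score N W F
      ≡⟨ solve 3 (λ a b c → a :+ c := (a :- b) :+ (b :+ c)) refl (score (suc M) W G) (score (suc M) W F) (score N W F) ⟩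
    (score (suc M) W G - score (suc M) W F) + (score (suc M) W F + score N W F)
      ≡⟨ cong (_+ (score (suc M) W F + score N W F)) equal ⟩
    (score N W G - score N W F) + (score (suc M) W F + score N W F)
      ≡⟨ solve 3 (λ a b c → (a :- b) :+ (c :+ b) := c :+ a) refl (score N W G) (score N W F) (score (suc M) W F) ⟩
    score (suc M) W F + score N W G ∎
    where open ≡-Reasoning

-- Truncation to a box

truncate : ℕ → Region → Region
truncate M F c = F c ∧ keep M c

keep-lo : ∀ M u → keep M (hi u) ≡ true → keep M (lo u) ≡ true
keep-lo M (k , zero  , y)     _  = refl
keep-lo M (k , suc x , zero)  _  = refl
keep-lo M (k , suc x , suc y) eq = cong₂ _∧_ (≤ᵇ-true (ℕₚ.≤-trans (proj₁ (hi-≥ (k , suc x , suc y))) (≤ᵇ-sound {proj₁ (hi (k , suc x , suc y))} (proj₁ (split k eq)))))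
                                             (≤ᵇ-true (ℕₚ.≤-trans (proj₂ (hi-≥ (k , suc x , suc y))) (≤ᵇ-sound {proj₂ (hi (k , suc x , suc y))} (proj₂ (split k eq)))))
  where
  ∧-split : ∀ {a b} → a ∧ b ≡ true → a ≡ true × b ≡ true
  ∧-split {true} {true} _ = refl , refl
  split : ∀ k → keep M (hi (k , suc x , suc y)) ≡ true →
          (proj₁ (hi (k , suc x , suc y)) ≤ᵇ M) ≡ true × (proj₂ (hi (k , suc x , suc y)) ≤ᵇ M) ≡ true
  split h = ∧-split
  split v = ∧-split
  split g = ∧-split

-- A line of cells leaving the box returns to the outside of F beyond the box; ψ marks the part cut off.
truncate-side : ∀ a b p q → (q ≡ true → p ≡ true) →
                ind ((a ∧ p) xor (b ∧ q)) + ind (a ∧ not p) ≤ ind (a xor b) + ind (b ∧ not q)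
truncate-side true  true  true  true  _  = decide-≤
truncate-side true  true  true  false _  = decide-≤
truncate-side true  true  false false _  = decide-≤
truncate-side true  false true  true  _  = decide-≤
truncate-side true  false true  false _  = decide-≤
truncate-side true  false false false _  = decide-≤
truncate-side false true  true  true  _  = decide-≤
truncate-side false true  true  false _  = decide-≤
truncate-side false true  false false _  = decide-≤
truncate-side false false true  true  _  = decide-≤
truncate-side false false true  false _  = decide-≤
truncate-side false false false false _  = decide-≤
truncate-side a     b     false true  q⇒p with () ← q⇒p refl

module _ {M Q} {W : Side → ℚ} {F : Region} (walled : walls ⊆ᴿ F) (confined : Confined Q F)
         (support : ∀ u → M ℕ.< proj₁ (lo u) ⊎ M ℕ.< proj₂ (lo u) → W u ≡ 0ℚ) where

  private
    ψ : Cell → ℚ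
    ψ c = ind (F c ∧ not (keep M c))

    shift : Side → Side
    shift (k , c) = k , hi (k , c)

    shift-injective : ∀ {u u′} → shift u ≡ shift u′ → u ≡ u′
    shift-injective {h , _} {h , _} refl = refl
    shift-injective {v , _} {v , _} refl = refl
    shift-injective {g , _} {g , _} refl = refl

    weight-equal : ∀ u → W u * ind (F (lo u)) ≡ W u * ind (truncate M F (lo u))
    weight-equal u with keep M (lo u) in eq
    ... | true  = cong (λ b → W u * ind b) (sym (∧-identityʳ (F (lo u))))
    ... | false = trans (cong (_* ind (F (lo u))) (support u (outside (lo u) eq)))
                 (trans (*-zeroˡ (ind (F (lo u))))
                 (trans (sym (*-zeroˡ (ind (F (lo u) ∧ false))))
                        (cong (_* ind (F (lo u) ∧ false)) (sym (support u (outside (lo u) eq))))))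
      where
      outside : ∀ c → keep M c ≡ false → M ℕ.< proj₁ c ⊎ M ℕ.< proj₂ c
      outside (suc x , suc y) eq with suc x ℕ.≤? M | suc y ℕ.≤? M
      ... | no  x≰ | _      = inj₁ (ℕₚ.≰⇒> x≰)
      ... | yes _  | no y≰  = inj₂ (ℕₚ.≰⇒> y≰)
      ... | yes x≤ | yes y≤ with () ← trans (sym (cong₂ _∧_ (≤ᵇ-true x≤) (≤ᵇ-true y≤))) eq

    pointwise : ∀ u → value W F u + ψ (lo u) ≤ value W (truncate M F) u + ψ (hi u)
    pointwise u = combine
      (truncate-side (F (lo u)) (F (hi u)) (keep M (lo u)) (keep M (hi u)) (keep-lo M u))
      (trans (cong (λ z → (ind (boundary F u) + ψ (hi u)) + ((z - ind (boundary F u)) + ψ (lo u))) (weight-equal u))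
        (solve 5 (λ d p z q d′ → (d :+ p) :+ ((z :- d) :+ q) := (d′ :+ q) :+ ((z :- d′) :+ p)) refl
          (ind (boundary F u)) (ψ (hi u)) (W u * ind (truncate M F (lo u))) (ψ (lo u)) (ind (boundary (truncate M F) u))))

    -- For each kind, `hi` moves cells injectively along a line, and `ψ` vanishes outside the window
    -- by `confined`. So the terms with `hi` are among the terms with `lo`, and the correction drops
    -- out of the sum.
    cut-off : ∀ {N} → suc Q ℕ.≤ N → ∑ (window N) (λ u → ψ (hi u)) ≤ ∑ (window N) (λ u → ψ (lo u))
    cut-off {N} Q<N = ≤-trans (≤-reflexive (sym (∑-map (window N) shift (λ u → ψ (lo u)))))
      (∑-embed (Uniqueₚ.map⁺ shift-injective (window-unique N)) (λ u → 0≤ind (F (lo u) ∧ not (keep M (lo u)))) (λ {u} _ → inside u))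
      where
      inside : ∀ u → u ∈ window N ⊎ ψ (lo u) ≡ 0ℚ
      inside (k , x , y) with window-or-far N k x y
      ... | inj₁ u∈ = inj₁ u∈
      ... | inj₂ N≤ = inj₂ (cong ind (trans (cong (_∧ not (keep M (x , y))) (far walled confined (Q< N≤))) wall-kept))
        where
        Q< : N ℕ.≤ x ⊎ N ℕ.≤ y → Q ℕ.< x ⊎ Q ℕ.< y
        Q< (inj₁ N≤x) = inj₁ (ℕₚ.≤-trans Q<N N≤x)
        Q< (inj₂ N≤y) = inj₂ (ℕₚ.≤-trans Q<N N≤y)
        wall-kept : walls (x , y) ∧ not (walls (x , y) ∨ inBox M (x , y)) ≡ false
        wall-kept with walls (x , y)
        ... | true  = refl
        ... | false = refl

  -- There is no weight outside the box to lose, and each side created by the cut is paid for by one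
  -- at which the same line of cells used to leave `F`. This turns a pocket found later into a
  -- competitor at an earlier time.
  score-truncate : ∀ {N} → suc Q ℕ.≤ N → score N W F ≤ score N W (truncate M F)
  score-truncate {N} Q<N = combine (+-mono-≤ (∑-mono (window N) pointwise) (cut-off Q<N))
    (trans (cong (λ z → (z + ∑ (window N) (λ u → ψ (lo u))) + score N W F) (∑-+ (window N) (value W (truncate M F)) (λ u → ψ (hi u))))
    (trans (solve 4 (λ a b c d → ((a :+ b) :+ c) :+ d := ((d :+ c) :+ b) :+ a) refl
             (score N W (truncate M F)) (∑ (window N) (λ u → ψ (hi u))) (∑ (window N) (λ u → ψ (lo u))) (score N W F))
      (cong (λ z → (z + ∑ (window N) (λ u → ψ (hi u))) + score N W (truncate M F)) (sym (∑-+ (window N) (value W F) (λ u → ψ (lo u)))))))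

-- Maximizing over finitely many candidate cells

insert : Cell → Region → Region
insert c F c′ = sameCell c c′ ∨ F c′

insert-self : ∀ c F → insert c F c ≡ true
insert-self c F rewrite sameCell-refl c = refl

insert-⊇ : ∀ c F → F ⊆ᴿ insert c F
insert-⊇ c F {c′} eq rewrite eq = ∨-zeroʳ (sameCell c c′)

insert-inv : ∀ c F {c′} → insert c F c′ ≡ true → c ≡ c′ ⊎ F c′ ≡ true
insert-inv c F {c′} eq with sameCell c c′ in eq′
... | true  = inj₁ (sameCell-≡ eq′)
... | false = inj₂ eq

-- Exhaustive search over the subsets of `cs`, so that the optimal region, and with it the strategy,
-- is given by a function.
best : (Region → ℚ) → List Cell → Region → Region
best Ψ []       F = F
best Ψ (c ∷ cs) F with Ψ (best Ψ cs F) ≤? Ψ (best Ψ cs (insert c F))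
... | yes _ = best Ψ cs (insert c F)
... | no  _ = best Ψ cs F

best-⊇ : ∀ Ψ cs F → F ⊆ᴿ best Ψ cs F
best-⊇ Ψ []       F eq = eq
best-⊇ Ψ (c ∷ cs) F eq with Ψ (best Ψ cs F) ≤? Ψ (best Ψ cs (insert c F))
... | yes _ = best-⊇ Ψ cs (insert c F) (insert-⊇ c F eq)
... | no  _ = best-⊇ Ψ cs F eq

best-⊆ : ∀ Ψ cs F {c} → best Ψ cs F c ≡ true → F c ≡ true ⊎ c ∈ cs
best-⊆ Ψ []       F eq = inj₁ eq
best-⊆ Ψ (c ∷ cs) F eq with Ψ (best Ψ cs F) ≤? Ψ (best Ψ cs (insert c F))
... | no  _ with best-⊆ Ψ cs F eq
...   | inj₁ Fc = inj₁ Fc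
...   | inj₂ c∈ = inj₂ (there c∈)
best-⊆ Ψ (c ∷ cs) F eq | yes _ with best-⊆ Ψ cs (insert c F) eq
...   | inj₂ c∈ = inj₂ (there c∈)
...   | inj₁ Ic with insert-inv c F Ic
...     | inj₁ refl = inj₂ (here refl)
...     | inj₂ Fc   = inj₁ Fc

-- `ext` stands in for function extensionality: the branch that follows `G` ends in a region that
-- agrees with `G` only pointwise.
best-optimal : ∀ (Ψ : Region → ℚ) → (∀ F G → (∀ c → F c ≡ G c) → Ψ F ≡ Ψ G) → ∀ cs F G →
               F ⊆ᴿ G → (∀ {c} → G c ≡ true → F c ≡ true ⊎ c ∈ cs) → Ψ G ≤ Ψ (best Ψ cs F)
best-optimal Ψ ext [] F G F⊆G G⊆F = ≤-reflexive (ext G F G≗F)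
  where
  G≗F : ∀ c → G c ≡ F c
  G≗F c with F c in eq | G c in eq′
  ... | true  | true  = refl
  ... | false | false = refl
  ... | true  | false = trans (sym eq′) (F⊆G eq)
  ... | false | true  with inj₁ Fc ← G⊆F eq′ = trans (sym Fc) eq
best-optimal Ψ ext (c ∷ cs) F G F⊆G G⊆F with G c in Gc
... | true  = ≤-trans (best-optimal Ψ ext cs (insert c F) G ins⊆G G⊆ins) second
  where
  ins⊆G : insert c F ⊆ᴿ G
  ins⊆G I with insert-inv c F I
  ... | inj₁ refl = Gc
  ... | inj₂ Fc′  = F⊆G Fc′
  G⊆ins : ∀ {c′} → G c′ ≡ true → insert c F c′ ≡ true ⊎ c′ ∈ cs
  G⊆ins Gc′ with G⊆F Gc′
  ... | inj₁ Fc′         = inj₁ (insert-⊇ c F Fc′)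
  ... | inj₂ (here refl) = inj₁ (insert-self c F)
  ... | inj₂ (there c∈)  = inj₂ c∈
  second : Ψ (best Ψ cs (insert c F)) ≤ Ψ (best Ψ (c ∷ cs) F)
  second with Ψ (best Ψ cs F) ≤? Ψ (best Ψ cs (insert c F))
  ... | yes _ = ≤-refl
  ... | no ¬p = <⇒≤ (≰⇒> ¬p)
... | false = ≤-trans (best-optimal Ψ ext cs F G F⊆G G⊆F′) first
  where
  G⊆F′ : ∀ {c′} → G c′ ≡ true → F c′ ≡ true ⊎ c′ ∈ cs
  G⊆F′ Gc′ with G⊆F Gc′
  ... | inj₁ Fc′         = inj₁ Fc′
  ... | inj₂ (there c∈)  = inj₂ c∈
  ... | inj₂ (here refl) with () ← trans (sym Gc) Gc′
  first : Ψ (best Ψ cs F) ≤ Ψ (best Ψ (c ∷ cs) F)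
  first with Ψ (best Ψ cs F) ≤? Ψ (best Ψ cs (insert c F))
  ... | yes p = p
  ... | no _  = ≤-refl

-- Filling the pocket enclosed by a closed chain

true≢false : ∀ {b : Bool} {A : Set} → b ≡ true → b ≡ false → A
true≢false refl ()

touch : Region → Side → Bool
touch free u = free (lo u) ∨ free (hi u)

double : ℚ → ℚ
double q = q + q

edgesAround : Cell → List Edge
edgesAround r = (r , east) ∷ (r , northeast) ∷ (r , north) ∷ (r , west) ∷ (r , southwest) ∷ (r , south) ∷ []

∑-touch : ∀ N {r} → Interior r → ∑ (window N) (λ u → ind (touch (sameCell r) u)) ≤ fromℕ 6
∑-touch N {r} int = ≤-trans
  (∑-embed {ys = map side (edgesAround r)} (window-unique N) (λ u → 0≤ind (touch (sameCell r) u)) (λ {u} _ → near int u))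
  (∑-mono (map side (edgesAround r)) {g = λ _ → 1ℚ} (λ u → ind≤1 (touch (sameCell r) u)))
  where
  near : ∀ {r} → Interior r → ∀ u → u ∈ map side (edgesAround r) ⊎ ind (touch (sameCell r) u) ≡ 0ℚ
  near {r} int u with sameCell r (lo u) in eq | sameCell r (hi u) in eq′
  near {r} int u | false | false = inj₂ refl
  near {r} int (h , _) | true | _ with refl ← sameCell-≡ {r} eq = inj₁ (here refl)
  near {r} int (v , _) | true | _ with refl ← sameCell-≡ {r} eq = inj₁ (there (there (here refl)))
  near {r} int (g , _) | true | _ with refl ← sameCell-≡ {r} eq = inj₁ (there (here refl))
  near {r} int (h , _) | false | true with refl ← sameCell-≡ {r} eq′ = inj₁ (there (there (there (here refl))))
  near {r} int (v , _) | false | true with refl ← sameCell-≡ {r} eq′ = inj₁ (there (there (there (there (there (here refl))))))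
  near {r} int (g , _) | false | true with refl ← sameCell-≡ {r} eq′ = inj₁ (there (there (there (there (here refl)))))

∑-touch-none : ∀ N → ∑ (window N) (λ u → ind (touch (λ _ → false) u)) ≡ 0ℚ
∑-touch-none N = ∑-zero (window N) (λ _ → refl)

-- The balance at a single side, where `p` and `q` tell whether it lies in the boundary stretch and
-- in the closing part of the chain. On the boundary stretch the winding number is 0 at the cell of
-- the region, hence 1 at the other cell, which gets filled: the side disappears. Off the chain both
-- winding numbers agree, so no boundary appears. A side touching a free cell is charged 2: one for
-- a possible new boundary side, one for `ind p`.
fill-side : ∀ a b wa wb fa fb p q →
            wa xor wb ≡ p xor q →
            (p ≡ true → (a ≡ true × b ≡ false × wa ≡ false) ⊎ (a ≡ false × b ≡ true × wb ≡ false)) →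
            (q ≡ true → fa ∨ fb ≡ true) →
            ind ((a ∨ (wa ∧ not fa)) xor (b ∨ (wb ∧ not fb))) + ind p ≤ ind (a xor b) + double (ind (fa ∨ fb))
fill-side a b wa wb true fb p q _ _ _ =
  ≤-trans (+-mono-≤ (ind≤1 ((a ∨ (wa ∧ false)) xor (b ∨ (wb ∧ not fb)))) (ind≤1 p)) (combine (0≤ind (a xor b)) (solve 1 (λ d → d :+ (con 1ℚ :+ con 1ℚ) := con 0ℚ :+ (d :+ (con 1ℚ :+ con 1ℚ))) refl (ind (a xor b))))
fill-side a b wa wb false true p q _ _ _ =
  ≤-trans (+-mono-≤ (ind≤1 ((a ∨ (wa ∧ true)) xor (b ∨ (wb ∧ false)))) (ind≤1 p)) (combine (0≤ind (a xor b)) (solve 1 (λ d → d :+ (con 1ℚ :+ con 1ℚ) := con 0ℚ :+ (d :+ (con 1ℚ :+ con 1ℚ))) refl (ind (a xor b))))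
fill-side a b wa wb false false p true _ _ touching with () ← touching refl
fill-side a b wa wb false false true false eq crossing _ with crossing refl
... | inj₁ (refl , refl , refl) with refl ← eq = decide-≤
... | inj₂ (refl , refl , refl) with wa | eq
...   | true | _ = decide-≤
fill-side true  true  wa    wb    false false false false eq _ _ = decide-≤
fill-side true  false false false false false false false eq _ _ = decide-≤
fill-side true  false true  true  false false false false eq _ _ = decide-≤
fill-side false true  false false false false false false eq _ _ = decide-≤
fill-side false true  true  true  false false false false eq _ _ = decide-≤
fill-side false false false false false false false false eq _ _ = decide-≤
fill-side false false true  true  false false false false eq _ _ = decide-≤
fill-side a     b     true  false false false false false () _ _
fill-side a     b     false true  false false false false () _ _

-- A closed mod 2 chain consists of a stretch A of the boundary of F, traversed with F on the left, and of
-- sides B touching free cells.  Adding to F the non-free cells enclosed by the chain removes A from the boundary.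
module Filling
  {F : Region} {A B : List Edge} {free : Region} {L : ℕ}
  (walled    : walls ⊆ᴿ F)
  (confined  : Confined L F)
  (interiors : ∀ {e} → e ∈ A ⊎ e ∈ B → Interior (right e) × (proj₁ (right e) ℕ.< L × proj₂ (right e) ℕ.< L))
  (onBoundary : ∀ {e} → e ∈ A → F (left e) ≡ true × F (right e) ≡ false)
  (distinct  : Unique (map side A))
  (touching  : ∀ {e} → e ∈ B → touch free (side e) ≡ true)
  (free-outside : ∀ {c} → free c ≡ true → F c ≡ false)
  (closed    : ∀ T → ∂ (λ u → parity A u xor parity B u) T ≡ false)
  where

  χ : Side → Bool
  χ u = parity A u xor parity B u

  w : Cell → Bool
  w = winding χ

  filled : Region
  filled c = F c ∨ (w c ∧ not (free c))

  private
    χ-∉ : ∀ {u} → (∀ {e} → e ∈ A ⊎ e ∈ B → side e ≢ u) → χ u ≡ false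
    χ-∉ avoid = cong₂ _xor_ (parity-∉ A (λ z → avoid (inj₁ z))) (parity-∉ B (λ z → avoid (inj₂ z)))

    wall : ∀ y → χ (v , 0 , y) ≡ false
    wall y = χ-∉ λ {e} e∈ → side-interior e (proj₁ (interiors e∈))

    bounded : ∀ {k x y} → L ℕ.≤ x ⊎ L ℕ.≤ y → χ (k , x , y) ≡ false
    bounded L≤ = χ-∉ λ {e} e∈ eq → outside e e∈ eq L≤
      where
      outside : ∀ e {k x y} → e ∈ A ⊎ e ∈ B → side e ≡ (k , x , y) → ¬ (L ℕ.≤ x ⊎ L ℕ.≤ y)
      outside e e∈ refl (inj₁ L≤x) = ℕₚ.<⇒≱ (proj₁ (proj₂ (interiors e∈))) (ℕₚ.≤-trans L≤x (proj₁ (side-bounded e)))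
      outside e e∈ refl (inj₂ L≤y) = ℕₚ.<⇒≱ (proj₂ (proj₂ (interiors e∈))) (ℕₚ.≤-trans L≤y (proj₂ (side-bounded e)))

  w-side : ∀ u → w (lo u) xor w (hi u) ≡ χ u
  w-side = winding-side χ closed wall

  w-edge : ∀ e → Interior (right e) → χ (side e) ≡ false → w (right e) ≡ w (left e)
  w-edge e int χ≡ with ends e int
  ... | inj₁ (eq , eq′) = trans (cong w (sym eq)) (trans (xor-false (trans (w-side (side e)) χ≡)) (cong w eq′))
  ... | inj₂ (eq , eq′) = trans (cong w (sym eq′)) (trans (sym (xor-false (trans (w-side (side e)) χ≡))) (cong w eq))

  -- The chain never separates two cells of `F`: an edge in `A` has its right cell outside `F`, and
  -- a side from `B` touches a free cell, which is outside `F` as well.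
  w-inside : ∀ u → F (lo u) ≡ true → F (hi u) ≡ true → w (lo u) ≡ w (hi u)
  w-inside u Flo Fhi = xor-false (trans (w-side u) (cong₂ _xor_ (notA (parity A u) refl) (notB (parity B u) refl)))
    where
    notA : ∀ b → parity A u ≡ b → parity A u ≡ false
    notA false eq = eq
    notA true  eq with parity-true A eq
    ... | e , e∈ , refl with ends e (proj₁ (interiors (inj₁ e∈)))
    ...   | inj₁ (eq₁ , _) = true≢false Flo (trans (cong F eq₁) (proj₂ (onBoundary e∈)))
    ...   | inj₂ (_ , eq₂) = true≢false Fhi (trans (cong F eq₂) (proj₂ (onBoundary e∈)))
    notB : ∀ b → parity B u ≡ b → parity B u ≡ false
    notB false eq = eq
    notB true  eq with parity-true B eq
    ... | e , e∈ , refl with free (lo (side e)) in f₁ | free (hi (side e)) in f₂ | touching e∈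
    ...   | true  | _    | _ = true≢false Flo (free-outside f₁)
    ...   | false | true | _ = true≢false Fhi (free-outside f₂)

  filled-⊇ : F ⊆ᴿ filled
  filled-⊇ eq rewrite eq = refl

  filled-confined : Confined L filled
  filled-confined {x , y} eq with F (x , y) in Fc
  ... | true  = confined Fc
  ... | false with w (x , y) in wc
  ...   | true with x ℕ.<? L | y ℕ.<? L
  ...     | yes x<L | yes y<L rewrite ≤ᵇ-true (ℕₚ.<⇒≤ x<L) | ≤ᵇ-true (ℕₚ.<⇒≤ y<L) = ∨-zeroʳ (walls (x , y))
  ...     | no  x≮L | _       = true≢false wc (winding-beyond χ closed wall bounded y (ℕₚ.≮⇒≥ x≮L))
  ...     | yes _   | no  y≮L = true≢false wc (winding-above χ closed wall bounded x (ℕₚ.≮⇒≥ y≮L))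

  -- A free cell is left unfilled. If `right e` is not free, then neither cell at the side is, so
  -- the side is off `B` too and the winding number 0 passes from left to right.
  filled-avoids : ∀ e → Interior (right e) → F (left e) ≡ true → F (right e) ≡ false → w (left e) ≡ false →
                  parity A (side e) ≡ false → filled (right e) ≡ false
  filled-avoids e int Fl Fr wl≡ A≡ with free (right e) in free-r
  ... | true  rewrite Fr = ∧-zeroʳ (w (right e))
  ... | false = trans (cong₂ (λ p q → p ∨ (q ∧ true)) Fr (trans (w-edge e int (cong₂ _xor_ A≡ (notB (parity B (side e)) refl))) wl≡)) refl
    where
    notB : ∀ b → parity B (side e) ≡ b → parity B (side e) ≡ false
    notB false eq = eq
    notB true  eq with parity-true B eq
    ... | f , f∈ , eq′ with subst (λ u → touch free u ≡ true) eq′ (touching f∈) | ends e int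
    ...   | touched | inj₁ (eq₁ , eq₂) rewrite eq₁ | eq₂ | free-r = true≢false Fl (free-outside touched)
    ...   | touched | inj₂ (eq₁ , eq₂) rewrite eq₁ | eq₂ with free (left e) in free-l
    ...     | true  = true≢false Fl (free-outside free-l)
    ...     | false = true≢false touched free-r

  module _ {W : Side → ℚ} (W≥0 : ∀ u → 0ℚ ≤ W u) (leftA : ∀ {e} → e ∈ A → w (left e) ≡ false) where

    private
      crossing : ∀ u → parity A u ≡ true →
        (F (lo u) ≡ true × F (hi u) ≡ false × w (lo u) ≡ false) ⊎ (F (lo u) ≡ false × F (hi u) ≡ true × w (hi u) ≡ false)
      crossing u odd with parity-true A odd
      ... | e , e∈ , refl with ends e (proj₁ (interiors (inj₁ e∈))) | onBoundary e∈
      ...   | inj₁ (eq₁ , eq₂) | Fl , Fr = inj₂ (trans (cong F eq₁) Fr , trans (cong F eq₂) Fl , trans (cong w eq₂) (leftA e∈))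
      ...   | inj₂ (eq₁ , eq₂) | Fl , Fr = inj₁ (trans (cong F eq₁) Fl , trans (cong F eq₂) Fr , trans (cong w eq₁) (leftA e∈))

      weights : ∀ u → W u * ind (F (lo u)) ≤ W u * ind (filled (lo u))
      weights u with F (lo u)
      ... | true  = ≤-refl
      ... | false = ≤-trans (≤-reflexive (*-zeroʳ (W u))) (*-nonNeg (W≥0 u) (0≤ind (w (lo u) ∧ not (free (lo u)))))

      pointwise : ∀ u → value W F u + ind (parity A u) ≤ value W filled u + double (ind (touch free u))
      pointwise u = combine
        (+-mono-≤ (weights u) (fill-side (F (lo u)) (F (hi u)) (w (lo u)) (w (hi u)) (free (lo u)) (free (hi u))
          (parity A u) (parity B u) (w-side u) (crossing u) touched))
        (solve 6 (λ a b d d′ p q → (b :+ (d :+ q)) :+ ((a :- d) :+ p) := (a :+ (d′ :+ p)) :+ ((b :- d′) :+ q)) refl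
          (W u * ind (F (lo u))) (W u * ind (filled (lo u))) (ind (boundary F u)) (ind (boundary filled u))
          (ind (parity A u)) (double (ind (touch free u))))
        where
        touched : parity B u ≡ true → free (lo u) ∨ free (hi u) ≡ true
        touched odd with parity-true B odd
        ... | e , e∈ , refl = touching e∈

      lengths : ∀ {N} → L ℕ.≤ N → fromℕ (length A) ≤ ∑ (window N) (λ u → ind (parity A u))
      lengths {N} L≤N = ≤-trans
        (≤-reflexive (sym (trans (∑-const (map side A) odd) (cong fromℕ (length-map side A)))))
        (∑-embed {xs = map side A} {ys = window N} distinct (λ u → 0≤ind (parity A u)) (λ u∈ → inj₁ (inWindow u∈)))
        where
        odd : ∀ {u} → u ∈ map side A → ind (parity A u) ≡ 1ℚ
        odd u∈ with ∈-map⁻ side u∈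
        ... | e , e∈ , refl = cong ind (parity-∈ A distinct e∈)
        inWindow : ∀ {u} → u ∈ map side A → u ∈ window N
        inWindow u∈ with ∈-map⁻ side u∈
        ... | e , e∈ , refl with proj₂ (interiors (inj₁ e∈)) | side-bounded e
        ...   | x<L , y<L | x≤ , y≤ = ∈-window _ (ℕₚ.≤-<-trans x≤ (ℕₚ.<-≤-trans x<L L≤N)) (ℕₚ.≤-<-trans y≤ (ℕₚ.<-≤-trans y<L L≤N))

    score-filled : ∀ {N} → L ℕ.≤ N →
                   score N W F + fromℕ (length A) ≤ score N W filled + double (∑ (window N) (λ u → ind (touch free u)))
    score-filled {N} L≤N = begin
      score N W F + fromℕ (length A)                                  ≤⟨ +-monoʳ-≤ (score N W F) (lengths L≤N) ⟩
      score N W F + ∑ (window N) (λ u → ind (parity A u))             ≡⟨ sym (∑-+ (window N) (value W F) (λ u → ind (parity A u))) ⟩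
      ∑ (window N) (λ u → value W F u + ind (parity A u))             ≤⟨ ∑-mono (window N) pointwise ⟩
      ∑ (window N) (λ u → value W filled u + double (ind (touch free u))) ≡⟨ ∑-+ (window N) (value W filled) (λ u → double (ind (touch free u))) ⟩
      score N W filled + ∑ (window N) (λ u → double (ind (touch free u))) ≡⟨ cong (score N W filled +_) (∑-+ (window N) (λ u → ind (touch free u)) (λ u → ind (touch free u))) ⟩
      score N W filled + double (∑ (window N) (λ u → ind (touch free u))) ∎
      where open ≤-Reasoning

-- Following the boundary of a region

-- The third cell at the head decides: if it belongs to `F` it becomes the new left cell, otherwise
-- it is entered.
next : Region → Edge → Edge
next F e = if F (left (turn e)) then turn e else step e

next-cases : ∀ F e → (F (left (turn e)) ≡ true × next F e ≡ turn e) ⊎ (F (left (turn e)) ≡ false × next F e ≡ step e)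
next-cases F e with F (left (turn e))
... | true  = inj₁ (refl , refl)
... | false = inj₂ (refl , refl)

ccw-cw : ∀ d → ccw (cw d) ≡ d
ccw-cw east      = refl
ccw-cw northeast = refl
ccw-cw north     = refl
ccw-cw west      = refl
ccw-cw southwest = refl
ccw-cw south     = refl

cw-ccw : ∀ d → cw (ccw d) ≡ d
cw-ccw east      = refl
cw-ccw northeast = refl
cw-ccw north     = refl
cw-ccw west      = refl
cw-ccw southwest = refl
cw-ccw south     = refl

turn-injective : ∀ {e f} → turn e ≡ turn f → e ≡ f
turn-injective {r , d} {r′ , d′} eq =
  cong₂ _,_ (cong proj₁ eq) (trans (sym (ccw-cw d)) (trans (cong ccw (cong proj₂ eq)) (ccw-cw d′)))

step-back : ∀ e → Interior (right e) → nb (ccw (proj₂ (step e))) (right (step e)) ≡ right e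
step-back (_ , east)      interior = refl
step-back (_ , northeast) interior = refl
step-back (_ , north)     interior = refl
step-back (_ , west)      interior = refl
step-back (_ , southwest) interior = refl
step-back (_ , south)     interior = refl

step-injective : ∀ {e f} → Interior (right e) → Interior (right f) → step e ≡ step f → e ≡ f
step-injective {e} {f} int int′ eq = cong₂ _,_
  (trans (sym (step-back e int)) (trans (cong (λ s → nb (ccw (proj₂ s)) (right s)) eq) (step-back f int′)))
  (trans (sym (cw-ccw (proj₂ e))) (trans (cong cw (cong proj₂ eq)) (cw-ccw (proj₂ f))))

turn≡step : ∀ e f → Interior (right f) → turn e ≡ step f → left e ≡ right f
turn≡step (r , d) f int eq =
  trans (cong (λ d → nb d r) (sym (ccw-cw d))) (trans (cong (λ s → nb (ccw (proj₂ s)) (right s)) eq) (step-back f int))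

-- `turn` and `step` are each invertible. If a turn and a step gave the same edge, the left cell of
-- one predecessor, in `F`, would be the right cell of the other, outside `F`.
next-injective : ∀ F {e f} → Interior (right e) → Interior (right f) →
                 F (left e) ≡ true → F (right e) ≡ false → F (left f) ≡ true → F (right f) ≡ false →
                 next F e ≡ next F f → e ≡ f
next-injective F {e} {f} int int′ Fle Fre Flf Frf eq with next-cases F e | next-cases F f
... | inj₁ (_ , p) | inj₁ (_ , q) = turn-injective (trans (sym p) (trans eq q))
... | inj₂ (_ , p) | inj₂ (_ , q) = step-injective int int′ (trans (sym p) (trans eq q))
... | inj₁ (_ , p) | inj₂ (_ , q) = true≢false Fle (trans (cong F (turn≡step e f int′ (trans (sym p) (trans eq q)))) Frf)
... | inj₂ (_ , p) | inj₁ (_ , q) = true≢false Flf (trans (cong F (turn≡step f e int (trans (sym q) (trans (sym eq) p)))) Fre)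

step-bound : ∀ d {B} r → proj₁ r ℕ.≤ B × proj₂ r ℕ.≤ B → proj₁ (nb d r) ℕ.≤ suc B × proj₂ (nb d r) ℕ.≤ suc B
step-bound east      r (p , q) = s≤s p , ℕₚ.m≤n⇒m≤1+n q
step-bound northeast r (p , q) = s≤s p , s≤s q
step-bound north     r (p , q) = ℕₚ.m≤n⇒m≤1+n p , s≤s q
step-bound west      r (p , q) = ℕₚ.m≤n⇒m≤1+n (ℕₚ.≤-trans ℕₚ.pred[n]≤n p) , ℕₚ.m≤n⇒m≤1+n q
step-bound southwest r (p , q) = ℕₚ.m≤n⇒m≤1+n (ℕₚ.≤-trans ℕₚ.pred[n]≤n p) , ℕₚ.m≤n⇒m≤1+n (ℕₚ.≤-trans ℕₚ.pred[n]≤n q)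
step-bound south     r (p , q) = ℕₚ.m≤n⇒m≤1+n p , ℕₚ.m≤n⇒m≤1+n (ℕₚ.≤-trans ℕₚ.pred[n]≤n q)

not-wall : ∀ {F : Region} → walls ⊆ᴿ F → ∀ c → F c ≡ false → Interior c
not-wall walled (zero  , _)     eq = true≢false (walled refl) eq
not-wall walled (suc _ , zero)  eq = true≢false (walled refl) eq
not-wall walled (suc _ , suc _) eq = interior

score-insert : ∀ N {W} {F r} → (∀ u → 0ℚ ≤ W u) → Interior r → F r ≡ false → (h , r) ∈ window N →
               score N W F + W (h , r) ≤ score N W (insert r F) + fromℕ 6
score-insert N {W} {F} {r} W≥0 int Fr r∈ = begin
  score N W F + W (h , r)                                  ≤⟨ +-monoʳ-≤ (score N W F) single ⟩
  score N W F + ∑ (window N) δ                             ≡⟨ sym (∑-+ (window N) (value W F) δ) ⟩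
  ∑ (window N) (λ u → value W F u + δ u)                   ≤⟨ ∑-mono (window N) pointwise ⟩
  ∑ (window N) (λ u → value W (insert r F) u + ind (touch (sameCell r) u)) ≡⟨ ∑-+ (window N) (value W (insert r F)) (λ u → ind (touch (sameCell r) u)) ⟩
  score N W (insert r F) + ∑ (window N) (λ u → ind (touch (sameCell r) u)) ≤⟨ +-monoʳ-≤ (score N W (insert r F)) (∑-touch N int) ⟩
  score N W (insert r F) + fromℕ 6 ∎
  where
  open ≤-Reasoning
  δ : Side → ℚ
  δ u = W u * ind (sameCell r (lo u))
  single : W (h , r) ≤ ∑ (window N) δ
  single = ≤-trans (≤-reflexive (sym (trans (+-identityʳ _) (trans (cong (λ b → W (h , r) * ind b) (sameCell-refl r)) (*-identityʳ _)))))
    (∑-embed {xs = (h , r) ∷ []} ([] ∷ []) (λ u → *-nonNeg (W≥0 u) (0≤ind (sameCell r (lo u)))) (λ { (here refl) → inj₁ r∈ }))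
  F-same : ∀ c → sameCell r c ≡ true → F c ≡ false
  F-same c eq = trans (cong F (sym (sameCell-≡ {r} {c} eq))) Fr
  cost : ∀ a b s s′ → (s ≡ true → a ≡ false) → (s′ ≡ true → b ≡ false) →
         ind ((s ∨ a) xor (s′ ∨ b)) ≤ ind (a xor b) + ind (s ∨ s′)
  cost a b true s′ _ _ = ≤-trans (ind≤1 (true xor (s′ ∨ b))) (combine (0≤ind (a xor b)) (solve 1 (λ d → d :+ con 1ℚ := con 0ℚ :+ (d :+ con 1ℚ)) refl (ind (a xor b))))
  cost a b false true _ _ = ≤-trans (ind≤1 (a xor true)) (combine (0≤ind (a xor b)) (solve 1 (λ d → d :+ con 1ℚ := con 0ℚ :+ (d :+ con 1ℚ)) refl (ind (a xor b))))
  cost a b false false _ _ = ≤-reflexive (sym (+-identityʳ _))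
  gain : ∀ a s → (s ≡ true → a ≡ false) → ind (s ∨ a) ≡ ind a + ind s
  gain a false _  = sym (+-identityʳ _)
  gain a true  eq rewrite eq refl = refl
  pointwise : ∀ u → value W F u + δ u ≤ value W (insert r F) u + ind (touch (sameCell r) u)
  pointwise u = combine
    (cost (F (lo u)) (F (hi u)) (sameCell r (lo u)) (sameCell r (hi u)) (F-same (lo u)) (F-same (hi u)))
    (trans (solve 6 (λ k p q d d′ j → (d :+ j) :+ ((k :* p :- d) :+ k :* q) := d′ :+ ((k :* (p :+ q) :- d′) :+ j)) refl
             (W u) (ind (F (lo u))) (ind (sameCell r (lo u))) (ind (boundary F u)) (ind (boundary (insert r F) u)) (ind (touch (sameCell r) u)))
      (cong (λ z → ind (boundary (insert r F) u) + ((W u * z - ind (boundary (insert r F) u)) + ind (touch (sameCell r) u)))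
        (sym (gain (F (lo u)) (sameCell r (lo u)) (F-same (lo u))))))

-- The walk driven by a growing weight

spread : (Cell → ℚ) → Side → ℚ
spread ω (h , c) = ω c
spread ω (v , _) = 0ℚ
spread ω (g , _) = 0ℚ

-- Weight outside the box of side reach t is not yet taken into account at time t.
reach : ℕ → ℕ
reach t = (t ℕ.+ 3) ℕ.+ (t ℕ.+ 3)

reach-mono : ∀ {s t} → s ℕ.≤ t → reach s ℕ.≤ reach t
reach-mono s≤t = ℕₚ.+-mono-≤ (ℕₚ.+-monoˡ-≤ 3 s≤t) (ℕₚ.+-monoˡ-≤ 3 s≤t)

keep-mono : ∀ {M M′} → M ℕ.≤ M′ → ∀ {c} → keep M c ≡ true → keep M′ c ≡ true
keep-mono {M} {M′} M≤M′ {x , y} eq with walls (x , y)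
... | true  = refl
... | false with x ≤ᵇ M in p | y ≤ᵇ M in q
...   | true | true = cong₂ _∧_ (≤ᵇ-true (ℕₚ.≤-trans (≤ᵇ-sound {x} p) M≤M′)) (≤ᵇ-true (ℕₚ.≤-trans (≤ᵇ-sound {y} q) M≤M′))

boxCells : ℕ → List Cell
boxCells M = cartesianProduct (map suc (upTo M)) (map suc (upTo M))

∈-boxCells : ∀ {M x y} → suc x ℕ.≤ M → suc y ℕ.≤ M → (suc x , suc y) ∈ boxCells M
∈-boxCells x< y< = ∈-cartesianProduct⁺ (∈-map⁺ suc (∈-upTo⁺ x<)) (∈-map⁺ suc (∈-upTo⁺ y<))

boxCells-inBox : ∀ {M} c → c ∈ boxCells M → inBox M c ≡ true
boxCells-inBox {M} (x , y) c∈ with ∈-cartesianProduct⁻ (map suc (upTo M)) (map suc (upTo M)) c∈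
... | x∈ , y∈ with ∈-map⁻ suc x∈ | ∈-map⁻ suc y∈
...   | _ , x∈′ , refl | _ , y∈′ , refl = cong₂ _∧_ (≤ᵇ-true (∈-upTo⁻ x∈′)) (≤ᵇ-true (∈-upTo⁻ y∈′))

unvisited : ℕ → List Cell → List Cell
unvisited M vs = filter (λ c → ¬? (c ∈? vs)) (boxCells M)

record State : Set where
  constructor state
  field
    region  : Region
    visited : List Cell
    edge    : Edge
open State

-- The region grows first and the edge then moves along the new boundary, so `ω t` is the latest
-- weight taken into account when the cell of time `suc t` is chosen.
extend : ℕ → (Cell → ℚ) → State → State
extend t ω (state F vs e) = state F′ (right (next F′ e) ∷ vs) (next F′ e)
  where
  F′ : Region
  F′ = best (score (suc (reach t)) (spread ω)) (unvisited (reach t) vs) F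

play : (ℕ → Cell → ℚ) → ℕ → State
-- The left cell of the first edge is `(0 , 1)`, a wall cell in column 0, where winding numbers are
-- 0.
play ω zero    = state walls ((1 , 1) ∷ []) ((1 , 1) , west)
play ω (suc t) = extend t (ω t) (play ω t)

-- The angel walks along the boundary of the current optimal region, with the region on her left.
module Walk (ω : ℕ → Cell → ℚ) where

  reg : ℕ → Region
  reg t = region (play ω t)

  e : ℕ → Edge
  e t = edge (play ω t)

  vis : ℕ → List Cell
  vis t = visited (play ω t)

  reg-step : ∀ t → reg t ⊆ᴿ reg (suc t)
  reg-step t = best-⊇ (score (suc (reach t)) (spread (ω t))) (unvisited (reach t) (vis t)) (reg t)

  reg-mono : ∀ {s t} → s ℕ.≤ t → reg s ⊆ᴿ reg t
  reg-mono {s} {t} s≤t = go (ℕₚ.≤⇒≤′ s≤t)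
    where
    go : ∀ {t} → s ℕ.≤′ t → reg s ⊆ᴿ reg t
    go ℕ.≤′-refl           eq = eq
    go (ℕ.≤′-step {n} s≤t) {c} eq = reg-step n {c} (go s≤t {c} eq)

  walled : ∀ t → walls ⊆ᴿ reg t
  walled t = reg-mono {0} {t} z≤n

  reg-new : ∀ t {c} → reg (suc t) c ≡ true → reg t c ≡ true ⊎ (c ∈ boxCells (reach t) × c ∉ vis t)
  reg-new t {c} eq with best-⊆ (score (suc (reach t)) (spread (ω t))) (unvisited (reach t) (vis t)) (reg t) eq
  ... | inj₁ Fc = inj₁ Fc
  ... | inj₂ c∈ = inj₂ (∈-filter⁻ (λ c → ¬? (c ∈? vis t)) {xs = boxCells (reach t)} c∈)

  right-current : ∀ t → right (e t) ∈ vis t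
  right-current zero    = here refl
  right-current (suc t) = here refl

  -- Visited cells are no candidates for the region. A turn stays in a visited cell, and a step
  -- enters a cell just found to be outside.
  vis-outside : ∀ t {c} → c ∈ vis t → reg t c ≡ false
  vis-outside′ : ∀ t {c} → c ∈ vis t → reg (suc t) c ≡ false

  vis-outside zero    (here refl) = refl
  vis-outside (suc t) (there c∈)  = vis-outside′ t c∈
  vis-outside (suc t) (here refl) with next-cases (reg (suc t)) (e t)
  ... | inj₁ (_ , eq)    = trans (cong (λ f → reg (suc t) (right f)) eq) (vis-outside′ t (right-current t))
  ... | inj₂ (out , eq) = trans (cong (λ f → reg (suc t) (right f)) eq) out

  vis-outside′ t {c} c∈ with reg (suc t) c in eq
  ... | false = refl
  ... | true with reg-new t eq
  ...   | inj₁ Fc       = sym (trans (sym (vis-outside t c∈)) Fc)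
  ...   | inj₂ (_ , c∉) = ⊥-elim (c∉ c∈)

  right-vis : ∀ {k t} → k ℕ.≤ t → right (e k) ∈ vis t
  right-vis {k} {t} k≤t = go (ℕₚ.≤⇒≤′ k≤t)
    where
    go : ∀ {t} → k ℕ.≤′ t → right (e k) ∈ vis t
    go ℕ.≤′-refl       = right-current k
    go (ℕ.≤′-step k≤t) = there (go k≤t)

  vis-right : ∀ t {c} → c ∈ vis t → ∃ λ k → k ℕ.≤ t × c ≡ right (e k)
  vis-right zero    (here refl) = 0 , z≤n , refl
  vis-right (suc t) (here refl) = suc t , ℕₚ.≤-refl , refl
  vis-right (suc t) (there c∈) with vis-right t c∈
  ... | k , k≤t , eq = k , ℕₚ.m≤n⇒m≤1+n k≤t , eq

  first-visit : ∀ t {c} → c ∈ vis t → ∃ λ i → i ℕ.≤ t × right (e i) ≡ c × (∀ j → i ≡ suc j → c ∉ vis j)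
  first-visit zero    (here refl) = 0 , z≤n , refl , λ _ ()
  first-visit (suc t) {c} c∈ with c ∈? vis t
  ... | yes c∈t with first-visit t c∈t
  ...   | i , i≤t , eq , first = i , ℕₚ.m≤n⇒m≤1+n i≤t , eq , first
  first-visit (suc t) (here refl) | no c∉t = suc t , ℕₚ.≤-refl , refl , λ { j refl → c∉t }
  first-visit (suc t) (there c∈)  | no c∉t = ⊥-elim (c∉t c∈)

  right-outside : ∀ {k t} → k ℕ.≤ t → reg t (right (e k)) ≡ false
  right-outside {k} {t} k≤t = vis-outside t (right-vis k≤t)

  right-interior : ∀ k → Interior (right (e k))
  right-interior k = not-wall (walled k) (right (e k)) (right-outside {k} ℕₚ.≤-refl)

  left-current : ∀ k → reg k (left (e k)) ≡ true
  left-current zero    = refl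
  left-current (suc k) with next-cases (reg (suc k)) (e k)
  ... | inj₁ (in′ , eq) = trans (cong (λ f → reg (suc k) (left f)) eq) in′
  ... | inj₂ (_ , eq)   = trans (cong (λ f → reg (suc k) (left f)) eq)
                         (trans (cong (reg (suc k)) (left-step (e k) (right-interior k))) (reg-step k (left-current k)))

  left-inside : ∀ {k t} → k ℕ.≤ t → reg t (left (e k)) ≡ true
  left-inside {k} k≤t = reg-mono k≤t (left-current k)

  -- A later region dictates the same step: a third cell that was in the region stays in it, and one
  -- that was entered is visited, hence never absorbed.
  e-next : ∀ {k t} → suc k ℕ.≤ t → e (suc k) ≡ next (reg t) (e k)
  e-next {k} {t} k<t with next-cases (reg (suc k)) (e k) | next-cases (reg t) (e k)
  ... | inj₁ (_ , eq)   | inj₁ (_ , eq′)   = trans eq (sym eq′)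
  ... | inj₂ (_ , eq)   | inj₂ (_ , eq′)   = trans eq (sym eq′)
  ... | inj₁ (in′ , _)  | inj₂ (out , _)   = true≢false (reg-mono k<t in′) out
  ... | inj₂ (_ , eq)   | inj₁ (in′ , _)   = true≢false in′ (trans (cong (λ f → reg t (right f)) (sym eq)) (right-outside k<t))

  right-bound : ∀ k → proj₁ (right (e k)) ℕ.≤ suc k × proj₂ (right (e k)) ℕ.≤ suc k
  right-bound zero    = ℕₚ.≤-refl , ℕₚ.≤-refl
  right-bound (suc k) with next-cases (reg (suc k)) (e k) | right-bound k
  ... | inj₁ (_ , eq) | p , q rewrite eq = ℕₚ.m≤n⇒m≤1+n p , ℕₚ.m≤n⇒m≤1+n q
  ... | inj₂ (_ , eq) | b     rewrite eq = step-bound (cw (proj₂ (e k))) (right (e k)) b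

  right-reach : ∀ {k t} → k ℕ.≤ suc t → proj₁ (right (e k)) ℕ.< reach t × proj₂ (right (e k)) ℕ.< reach t
  right-reach {k} {t} k≤ = ℕₚ.≤-trans (s≤s (proj₁ (right-bound k))) bound , ℕₚ.≤-trans (s≤s (proj₂ (right-bound k))) bound
    where
    bound : suc (suc k) ℕ.≤ reach t
    bound = ℕₚ.≤-trans (ℕₚ.≤-trans (s≤s (s≤s k≤)) (ℕₚ.≤-reflexive (ℕₚ.+-comm 3 t))) (ℕₚ.m≤m+n (t ℕ.+ 3) (t ℕ.+ 3))

  confined : ∀ t → Confined (reach t) (reg t)
  confined′ : ∀ t → Confined (reach t) (reg (suc t))
  confined zero    eq rewrite eq = refl
  confined (suc t) {c} eq = keep-mono (reach-mono (ℕₚ.n≤1+n t)) {c} (confined′ t eq)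
  confined′ t {c} eq with reg-new t eq
  ... | inj₁ Fc       = confined t Fc
  ... | inj₂ (c∈ , _) = trans (cong (walls c ∨_) (boxCells-inBox c c∈)) (∨-zeroʳ (walls c))

  -- The form needed for pockets: the competitor has to contain only the previous region, and the
  -- window may be enlarged, so that scores of different times can be compared in a common one.
  optimal : ∀ t {N G} → suc (reach t) ℕ.≤ N → reg t ⊆ᴿ G → Confined (reach t) G → (∀ {c} → c ∈ vis t → G c ≡ false) →
            score N (spread (ω t)) G ≤ score N (spread (ω t)) (reg (suc t))
  optimal t {N} {G} t<N F⊆G confinedG avoid =
    score-window {W = spread (ω t)} (λ eq → F⊆G (walled t eq)) (walled (suc t)) confinedG (confined′ t) t<N
      (best-optimal (score (suc (reach t)) (spread (ω t))) (score-cong (suc (reach t)) (spread (ω t)))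
        (unvisited (reach t) (vis t)) (reg t) G F⊆G (λ {c} → candidates c))
    where
    candidates : ∀ c → G c ≡ true → reg t c ≡ true ⊎ c ∈ unvisited (reach t) (vis t)
    candidates (zero  , y)     Gc = inj₁ (walled t refl)
    candidates (suc x , zero)  Gc = inj₁ (walled t refl)
    -- `suc x ≤ᵇ n` unfolds to `x <ᵇ n`, which is the form that has to be abstracted.
    candidates (suc x , suc y) Gc with x ℕ.<ᵇ reach t in p | y ℕ.<ᵇ reach t in q | confinedG Gc
    ... | true | true | _ = inj₂ (∈-filter⁺ (λ c → ¬? (c ∈? vis t))
            (∈-boxCells {reach t} (≤ᵇ-sound {suc x} p) (≤ᵇ-sound {suc y} q)) (λ c∈ → true≢false Gc (avoid c∈)))

head-next : ∀ F f → Interior (right f) → head f ≡ tail (next F f)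
head-next F f int with next-cases F f
... | inj₁ (_ , eq) = cong tail (sym eq)
... | inj₂ (_ , eq) = trans (head-step f int) (cong tail (sym eq))

spread-mono : ∀ {ω ω′ : Cell → ℚ} → (∀ c → ω c ≤ ω′ c) → ∀ u → spread ω u ≤ spread ω′ u
spread-mono le (h , c) = le c
spread-mono le (v , c) = ≤-refl
spread-mono le (g , c) = ≤-refl

spread-zero : ∀ {ω : Cell → ℚ} u → ω (lo u) ≡ 0ℚ → spread ω u ≡ 0ℚ
spread-zero (h , c) eq = eq
spread-zero (v , c) eq = refl
spread-zero (g , c) eq = refl

-- Entered cells are light when the weight grows slowly

record SlowGrowth (ω : ℕ → Cell → ℚ) (ε : ℚ) : Set where
  field
    initially : ∀ c → ω 0 c ≡ 0ℚ
    growing   : ∀ t c → ω t c ≤ ω (suc t) c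
    slowly    : ∀ t N → ∑ (window N) (λ u → spread (ω (suc t)) u - spread (ω t) u) ≤ ε
    supported : ∀ t c → reach t ℕ.< proj₁ c ⊎ reach t ℕ.< proj₂ c → ω t c ≡ 0ℚ

module Survival {ω : ℕ → Cell → ℚ} {ε : ℚ} (slow : SlowGrowth ω ε) (small : fromℕ 25 * ε ≤ 1ℚ) where

  open SlowGrowth slow
  open Walk ω

  W : ℕ → Side → ℚ
  W t = spread (ω t)

  ω≥0 : ∀ t c → 0ℚ ≤ ω t c
  ω≥0 zero    c = ≤-reflexive (sym (initially c))
  ω≥0 (suc t) c = ≤-trans (ω≥0 t c) (growing t c)

  W-mono : ∀ t u → W t u ≤ W (suc t) u
  W-mono t = spread-mono (growing t)

  W≥0 : ∀ t u → 0ℚ ≤ W t u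
  W≥0 t (h , c) = ω≥0 t c
  W≥0 t (v , c) = ≤-refl
  W≥0 t (g , c) = ≤-refl

  ε≥0 : 0ℚ ≤ ε
  ε≥0 = ≤-trans (∑-nonNeg (window 0) (λ u → 0≤-diff (W-mono 0 u))) (slowly 0 0)

  suc-* : ∀ a m → (a + fromℕ m * ε) + ε ≡ a + fromℕ (suc m) * ε
  suc-* a m = solve 3 (λ a n e → (a :+ n :* e) :+ e := a :+ (con 1ℚ :+ n) :* e) refl a (fromℕ m) ε

  score-later : ∀ m i N G → score N (W (m ℕ.+ i)) G ≤ score N (W i) G + fromℕ m * ε
  score-later zero    i N G = ≤-reflexive (solve 2 (λ a e → a := a :+ con 0ℚ :* e) refl (score N (W i) G) ε)
  score-later (suc m) i N G = ≤-trans (score-increment N G (W-mono (m ℕ.+ i)))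
    (≤-trans (+-mono-≤ (score-later m i N G) (slowly (m ℕ.+ i) N)) (≤-reflexive (suc-* (score N (W i) G) m)))

  ω-increment : ∀ t c → ω (suc t) c ≤ ω t c + ε
  ω-increment t c@(x , y) = combine (≤-trans single (slowly t N))
    (solve 3 (λ e a b → e :+ a := (a :- b :+ con 0ℚ) :+ (b :+ e)) refl ε (ω (suc t) c) (ω t c))
    where
    N : ℕ
    N = suc (x ℕ.+ y)
    single : ω (suc t) c - ω t c + 0ℚ ≤ ∑ (window N) (λ u → W (suc t) u - W t u)
    single = ∑-embed {xs = (h , c) ∷ []} {f = λ u → W (suc t) u - W t u} ([] ∷ []) (λ u → 0≤-diff (W-mono t u))
      (λ { (here refl) → inj₁ (∈-window h (s≤s (ℕₚ.m≤m+n x y)) (s≤s (ℕₚ.m≤n+m y x))) })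

  ω-later : ∀ m i c → ω (m ℕ.+ i) c ≤ ω i c + fromℕ m * ε
  ω-later zero    i c = ≤-reflexive (solve 2 (λ a e → a := a :+ con 0ℚ :* e) refl (ω i c) ε)
  ω-later (suc m) i c = ≤-trans (ω-increment (m ℕ.+ i) c)
    (≤-trans (+-monoˡ-≤ ε (ω-later m i c)) (≤-reflexive (suc-* (ω i c) m)))

  -- The optimum never drops: weights grow, and the old region remains a competitor.
  score-increasing : ∀ {i t N} → i ℕ.≤ t → suc (reach t) ℕ.≤ N → score N (W i) (reg (suc i)) ≤ score N (W t) (reg (suc t))
  score-increasing {i} {t} {N} i≤t = go (ℕₚ.≤⇒≤′ i≤t)
    where
    go : ∀ {t} → i ℕ.≤′ t → suc (reach t) ℕ.≤ N → score N (W i) (reg (suc i)) ≤ score N (W t) (reg (suc t))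
    go ℕ.≤′-refl           _   = ≤-refl
    go (ℕ.≤′-step {s} i≤s) s<N = ≤-trans (go i≤s (ℕₚ.≤-trans (s≤s (reach-mono (ℕₚ.n≤1+n s))) s<N))
      (≤-trans (score-mono N (reg (suc s)) (W-mono s))
        (optimal (suc s) s<N (λ eq → eq) (confined (suc s)) (vis-outside (suc s))))

  DistinctUpTo : ℕ → Set
  DistinctUpTo t = ∀ p q → p ℕ.< q → q ℕ.≤ t → e p ≢ e q

  -- No side is traversed in both directions, because left cells are in the current region and right
  -- cells are outside it.
  sides-distinct : ∀ {t} → DistinctUpTo t → ∀ p q → p ℕ.< q → q ℕ.≤ t → side (e p) ≢ side (e q)
  sides-distinct {t} distinct p q p<q q≤t eq with side-injective (right-interior p) (right-interior q) eq
  ... | inj₁ ep≡eq = distinct p q p<q q≤t ep≡eq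
  ... | inj₂ r≡l   = true≢false (left-inside {p} {t} (ℕₚ.≤-trans (ℕₚ.<⇒≤ p<q) q≤t))
                                (trans (cong (reg t) (sym r≡l)) (right-outside q≤t))

  -- The walk from e i to e (t + 1), closed up by j turns around the cell right (e i).
  module Loop (m i j : ℕ) (free : Region) (distinct : DistinctUpTo (m ℕ.+ i))
    (close : (right (e i) , turns (proj₂ (e i)) j) ≡ e (suc (m ℕ.+ i)))
    (free-outside : ∀ {c} → free c ≡ true → reg (suc (m ℕ.+ i)) c ≡ false)
    (touching : ∀ {f} → f ∈ path (λ k → right (e i) , turns (proj₂ (e i)) k) j → touch free (side f) ≡ true)
    where

    t N : ℕ
    t = m ℕ.+ i
    N = suc (reach t)

    F : Region
    F = reg (suc t)

    i≤t : i ℕ.≤ t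
    i≤t = ℕₚ.m≤n+m i m

    walk around : ℕ → Edge
    walk k = e (k ℕ.+ i)
    around k = right (e i) , turns (proj₂ (e i)) k

    A B : List Edge
    A = path walk (suc m)
    B = path around j

    A-inv : ∀ {f} → f ∈ A → ∃ λ k → k ℕ.≤ t × i ℕ.≤ k × f ≡ e k
    A-inv f∈ with ∈-path walk (suc m) f∈
    ... | k , s≤s k≤m , eq = k ℕ.+ i , ℕₚ.+-monoˡ-≤ i k≤m , ℕₚ.m≤n+m i k , eq

    onBoundary : ∀ {f} → f ∈ A → F (left f) ≡ true × F (right f) ≡ false
    onBoundary f∈ with A-inv f∈
    ... | k , k≤t , _ , refl = left-inside (ℕₚ.m≤n⇒m≤1+n k≤t) , right-outside (ℕₚ.m≤n⇒m≤1+n k≤t)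

    interiors : ∀ {f} → f ∈ A ⊎ f ∈ B → Interior (right f) × (proj₁ (right f) ℕ.< reach t × proj₂ (right f) ℕ.< reach t)
    interiors (inj₁ f∈) with A-inv f∈
    ... | k , k≤t , _ , refl = right-interior k , right-reach (ℕₚ.m≤n⇒m≤1+n k≤t)
    interiors (inj₂ f∈) with ∈-path around j f∈
    ... | _ , _ , refl = right-interior i , right-reach (ℕₚ.m≤n⇒m≤1+n i≤t)

    unique : Unique (map side A)
    unique = path-unique walk (suc m) λ p q p<q q≤m →
      sides-distinct distinct (p ℕ.+ i) (q ℕ.+ i) (ℕₚ.+-monoˡ-< i p<q) (ℕₚ.+-monoˡ-≤ i (ℕₚ.≤-pred q≤m))

    -- Both parts lead from `tail (e i)` to `tail (e (suc t))`; mod 2 it does not matter that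
    -- neither is reversed.
    closed : ∀ T → ∂ (λ u → parity A u xor parity B u) T ≡ false
    closed T = begin
      ∂ (λ u → parity A u xor parity B u) T
        ≡⟨ ∂-xor (parity A) (parity B) T ⟩
      ∂ (parity A) T xor ∂ (parity B) T
        ≡⟨ cong₂ _xor_ (∂-path walk (suc m) linked T) (∂-path around j (λ k _ → right-interior i , refl) T) ⟩
      ends-at (e (suc t)) xor (sameTriangle (tail (e i)) T xor sameTriangle (tail (around j)) T)
        ≡⟨ cong (λ f → ends-at (e (suc t)) xor ends-at f) close ⟩
      ends-at (e (suc t)) xor ends-at (e (suc t))
        ≡⟨ xor-same (ends-at (e (suc t))) ⟩
      false ∎
      where
      open ≡-Reasoning
      ends-at : Edge → Bool
      ends-at f = sameTriangle (tail (e i)) T xor sameTriangle (tail f) T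
      linked : ∀ k → k ℕ.< suc m → Interior (right (walk k)) × head (walk k) ≡ tail (walk (suc k))
      linked k (s≤s k≤m) = right-interior (k ℕ.+ i) ,
        trans (head-next F (walk k) (right-interior (k ℕ.+ i))) (cong tail (sym (e-next {k ℕ.+ i} (s≤s (ℕₚ.+-monoˡ-≤ i k≤m)))))

    open Filling {F} {A} {B} {free} {reach t} (walled (suc t)) (confined′ t) interiors onBoundary unique touching free-outside closed public

    -- Consecutive left cells are equal or adjacent within `F`, and the chain separates no two
    -- adjacent cells of `F`; so the value 0 at the initial wall cell persists along the whole walk.
    w-left : ∀ k → k ℕ.≤ suc t → w (left (e k)) ≡ false
    w-left zero    _   = refl
    w-left (suc k) k<t with next-cases F (e k) | w-left k (ℕₚ.<⇒≤ k<t)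
    ... | inj₂ (_ , eq) | wk = trans (cong (λ f → w (left f)) (trans (e-next {k} k<t) eq))
                              (trans (cong w (left-step (e k) (right-interior k))) wk)
    ... | inj₁ (in′ , eq) | wk = trans (cong (λ f → w (left f)) (trans (e-next {k} k<t) eq)) (trans (sym same-w) wk)
      where
      same-w : w (left (e k)) ≡ w (left (turn (e k)))
      same-w with left-left (e k) (right-interior k)
      ... | u , inj₁ (eq₁ , eq₂) = trans (cong w (sym eq₁)) (trans (w-inside u (trans (cong F eq₁) (left-inside (ℕₚ.<⇒≤ k<t))) (trans (cong F eq₂) in′)) (cong w eq₂))
      ... | u , inj₂ (eq₁ , eq₂) = trans (cong w (sym eq₂)) (trans (sym (w-inside u (trans (cong F eq₁) in′) (trans (cong F eq₂) (left-inside (ℕₚ.<⇒≤ k<t))))) (cong w eq₁))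

    -- This is what makes the pocket admissible at time `i`: an edge before time `i` has winding
    -- number 0 on its left, and its side is not in `A`, since no side is repeated.
    earlier-outside : ∀ k → k ℕ.< i → filled (right (e k)) ≡ false
    earlier-outside k k<i = filled-avoids (e k) (right-interior k) (left-inside k≤) (right-outside k≤) (w-left k k≤)
      (parity-∉ A λ f∈ eq → not-later (A-inv f∈) eq)
      where
      k≤ : k ℕ.≤ suc t
      k≤ = ℕₚ.≤-trans (ℕₚ.<⇒≤ k<i) (ℕₚ.m≤n⇒m≤1+n i≤t)
      not-later : ∀ {f} → (∃ λ l → l ℕ.≤ t × i ℕ.≤ l × f ≡ e l) → side f ≢ side (e k)
      not-later (l , l≤t , i≤l , refl) eq = sides-distinct distinct k l (ℕₚ.<-≤-trans k<i i≤l) l≤t (sym eq)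

    -- A circle of comparisons: at time `t` filling raises the score by `suc m`, up to the charge
    -- for free cells; the filled region scored at most `fromℕ m * ε` less at time `i`; there it did
    -- not beat the optimum; and the optimum has not dropped by time `t`.
    loop-short : score N (W i) filled ≤ score N (W i) (reg (suc i)) →
                 fromℕ (suc m) ≤ fromℕ m * ε + double (∑ (window N) (λ u → ind (touch free u)))
    loop-short not-better = combine
      (+-mono-≤ (+-mono-≤ shortcut (score-later m i N filled)) (+-mono-≤ not-better (score-increasing i≤t ℕₚ.≤-refl)))
      (solve 7 (λ a n b q b′ s x → ((b :+ q) :+ (b′ :+ x)) :+ (s :+ a) :+ n := ((a :+ n) :+ b) :+ (b′ :+ s) :+ (x :+ q)) refl
        (score N (W t) F) (fromℕ (suc m)) (score N (W t) filled) (double (∑ (window N) (λ u → ind (touch free u))))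
        (score N (W i) filled) (score N (W i) (reg (suc i))) (fromℕ m * ε))
      where
      A-edges : ∀ {f} → f ∈ A → w (left f) ≡ false
      A-edges f∈ with A-inv f∈
      ... | k , k≤t , _ , refl = w-left k (ℕₚ.m≤n⇒m≤1+n k≤t)
      shortcut : score N (W t) F + fromℕ (suc m) ≤ score N (W t) filled + double (∑ (window N) (λ u → ind (touch free u)))
      shortcut = subst (λ l → score N (W t) F + fromℕ l ≤ score N (W t) filled + double (∑ (window N) (λ u → ind (touch free u))))
        (length-path walk (suc m)) (score-filled (W≥0 t) A-edges (ℕₚ.n≤1+n (reach t)))

  25ε : ∀ m → fromℕ 25 * (fromℕ m * ε) ≤ fromℕ m
  25ε m = begin
    fromℕ 25 * (fromℕ m * ε) ≡⟨ solve 3 (λ a b c → a :* (b :* c) := (a :* c) :* b) refl (fromℕ 25) (fromℕ m) ε ⟩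
    (fromℕ 25 * ε) * fromℕ m ≤⟨ *-mono-nonNeg (fromℕ m) (0≤fromℕ m) small ⟩
    1ℚ * fromℕ m             ≡⟨ *-identityˡ (fromℕ m) ⟩
    fromℕ m                  ∎
    where open ≤-Reasoning

  -- At time 0 there is no weight, so shrinking a region to the walls cannot decrease its score.
  never-restarts : ∀ m → DistinctUpTo (m ℕ.+ 0) → e (suc (m ℕ.+ 0)) ≢ e 0
  never-restarts m distinct eq = impossible
    (L.loop-short (≤-trans (score-truncate {0} {W = W 0} (λ eq → L.filled-⊇ (walled (suc L.t) eq)) L.filled-confined (λ u _ → spread-zero {ω 0} u (initially (lo u))) ℕₚ.≤-refl)
      (≤-trans (≤-reflexive (score-cong L.N (W 0) (truncate 0 L.filled) walls truncated))
        (optimal 0 (s≤s (reach-mono {0} {L.t} z≤n)) (λ eq → eq) (λ {c} eq → cong (_∨ inBox (reach 0) c) eq) (λ { (here refl) → refl })))))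
    where
    module L = Loop m 0 0 (λ _ → false) distinct (sym eq) (λ ()) (λ ())
    truncated : ∀ c → truncate 0 L.filled c ≡ walls c
    truncated c@(zero  , y)     = cong (_∧ true) (L.filled-⊇ (walled (suc L.t) {c} refl))
    truncated c@(suc x , zero)  = cong (_∧ true) (L.filled-⊇ (walled (suc L.t) {c} refl))
    truncated c@(suc x , suc y) = ∧-zeroʳ (L.filled c)
    impossible : ¬ (fromℕ (suc m) ≤ fromℕ m * ε + double (∑ (window L.N) (λ u → ind (touch (λ _ → false) u))))
    -- Multiplied by 25, the bound `suc m ≤ m * ε` yields `25 + 25 m ≤ m`, hence `25 ≤ 0`.
    impossible le = from-no (fromℕ 25 ≤? 0ℚ)
      (combine (+-mono-≤ (+-mono-≤ (*-mono-nonNeg (fromℕ 25) (0≤fromℕ 25) le′) (25ε m)) (*-mono-nonNeg (fromℕ 24) (0≤fromℕ 24) (0≤fromℕ m)))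
        (solve 2 (λ y n → ((y :* con (fromℕ 25) :+ n) :+ n :* con (fromℕ 24)) :+ con (fromℕ 25) :=
                          ((((con 1ℚ :+ n) :* con (fromℕ 25)) :+ con (fromℕ 25) :* y) :+ con 0ℚ :* con (fromℕ 24)) :+ con 0ℚ)
          refl (fromℕ m * ε) (fromℕ m)))
      where
      le′ : fromℕ (suc m) ≤ fromℕ m * ε
      le′ = ≤-trans le (≤-reflexive (trans (cong (λ z → fromℕ m * ε + double z) (∑-touch-none L.N)) (+-identityʳ _)))

  -- All steps so far follow one injective map, `next` for the current region, so a repetition can
  -- be pulled back to a return to `e 0`.
  distinct : ∀ t → DistinctUpTo t
  distinct zero    p       .0 () z≤n
  distinct (suc t) p q p<q q≤ eq with ℕₚ.m≤n⇒m<n∨m≡n q≤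
  ... | inj₁ (s≤s q≤t) = distinct t p q p<q q≤t eq
  distinct (suc t) zero    .(suc t) p<q       q≤ eq | inj₂ refl =
    never-restarts t (subst DistinctUpTo (sym (ℕₚ.+-identityʳ t)) (distinct t)) (trans (cong (λ s → e (suc s)) (ℕₚ.+-identityʳ t)) (sym eq))
  distinct (suc t) (suc p) .(suc t) (s≤s p<t) q≤ eq | inj₂ refl = distinct t p t p<t ℕₚ.≤-refl
    (next-injective (reg (suc t)) (right-interior p) (right-interior t) (left-inside p≤) (right-outside p≤) (left-inside (ℕₚ.n≤1+n t)) (right-outside (ℕₚ.n≤1+n t))
      (trans (sym (e-next {p} (ℕₚ.m≤n⇒m≤1+n p<t))) (trans eq (e-next {t} ℕₚ.≤-refl))))
    where
    p≤ : p ℕ.≤ suc t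
    p≤ = ℕₚ.m≤n⇒m≤1+n (ℕₚ.<⇒≤ p<t)

  -- The loop is closed by turning around the revisited cell, the only free one. Its six sides are
  -- charged twice, so `suc m` is at most `m * ε + 12`.
  revisit-soon : ∀ m i → right (e i) ≡ right (e (suc (m ℕ.+ i))) → fromℕ (suc m) * ε ≤ 1ℚ
  revisit-soon m i same-cell with turns-reach (proj₂ (e i)) (proj₂ (e (suc (m ℕ.+ i))))
  ... | j , turned = bound (L.loop-short (≤-trans (score-truncate {reach i} {W = W i} (λ eq → L.filled-⊇ (walled (suc L.t) eq)) L.filled-confined
                              (λ u M< → spread-zero {ω i} u (supported i (lo u) M<)) ℕₚ.≤-refl)
                            (optimal i (s≤s (reach-mono L.i≤t)) base⊆ confined-truncate avoid)))
    where
    r : Cell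
    r = right (e i)
    r-touched : ∀ {f} → f ∈ path (λ k → r , turns (proj₂ (e i)) k) j → touch (sameCell r) (side f) ≡ true
    r-touched f∈ with ∈-path (λ k → r , turns (proj₂ (e i)) k) j f∈
    ... | k , _ , refl with ends (r , turns (proj₂ (e i)) k) (right-interior i)
    ...   | inj₁ (eq , _) rewrite eq | sameCell-refl r = refl
    ...   | inj₂ (_ , eq) rewrite eq | sameCell-refl r = ∨-zeroʳ _
    module L = Loop m i j (sameCell r) (distinct (m ℕ.+ i)) (cong₂ _,_ same-cell turned)
      (λ {c} eq → trans (cong (reg (suc (m ℕ.+ i))) (sym (sameCell-≡ {r} {c} eq))) (right-outside (ℕₚ.m≤n⇒m≤1+n (ℕₚ.m≤n+m i m))))
      r-touched
    base⊆ : reg i ⊆ᴿ truncate (reach i) L.filled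
    base⊆ {c} eq = cong₂ _∧_ (L.filled-⊇ (reg-mono (ℕₚ.m≤n⇒m≤1+n L.i≤t) {c} eq)) (confined i {c} eq)
    confined-truncate : Confined (reach i) (truncate (reach i) L.filled)
    confined-truncate {c} eq with L.filled c
    ... | true = eq
    avoid : ∀ {c} → c ∈ vis i → truncate (reach i) L.filled c ≡ false
    avoid c∈ with vis-right i c∈
    ... | k , k≤i , refl with ℕₚ.m≤n⇒m<n∨m≡n k≤i
    ...   | inj₁ k<i  = cong (_∧ _) (L.earlier-outside k k<i)
    ...   | inj₂ refl = cong (_∧ _) (cong₂ _∨_ (right-outside {i} (ℕₚ.m≤n⇒m≤1+n L.i≤t))
                          (trans (cong (λ b → L.w r ∧ not b) (sameCell-refl r)) (∧-zeroʳ (L.w r))))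
    bound : fromℕ (suc m) ≤ fromℕ m * ε + double (∑ (window L.N) (λ u → ind (touch (sameCell r) u))) → fromℕ (suc m) * ε ≤ 1ℚ
    -- From `25 (suc m) ε ≤ suc m ≤ m ε + 12` follows even `24 (suc m) ε ≤ 12`; the right side is
    -- relaxed to 24.
    bound le = *-cancelˡ-≤-pos (fromℕ 24) (combine
      (+-mono-≤ (+-mono-≤ le (+-mono-≤ six six)) (+-mono-≤ (25ε (suc m)) (+-mono-≤ ε≥0 (decide-≤ {fromℕ 12} {fromℕ 24}))))
      (solve 3 (λ n s ε → ((n :* ε :+ (s :+ s)) :+ (con (fromℕ 6) :+ con (fromℕ 6))) :+ ((con 1ℚ :+ n) :+ (ε :+ con (fromℕ 24))) :+ con (fromℕ 24) :* ((con 1ℚ :+ n) :* ε) :=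
                          (((con 1ℚ :+ n) :+ (s :+ s)) :+ (con (fromℕ 25) :* ((con 1ℚ :+ n) :* ε) :+ (con 0ℚ :+ con (fromℕ 12)))) :+ con (fromℕ 24) :* con 1ℚ)
        refl (fromℕ m) (∑ (window L.N) (λ u → ind (touch (sameCell r) u))) ε))
      where
      six : ∑ (window L.N) (λ u → ind (touch (sameCell r) u)) ≤ fromℕ 6
      six = ∑-touch L.N (right-interior i)

  fresh-light : ∀ t → right (e (suc t)) ∉ vis t → ω t (right (e (suc t))) ≤ fromℕ 6
  fresh-light t fresh = combine
    (+-mono-≤ (score-insert N (W≥0 t) (right-interior (suc t)) r∉ (∈-window h (ℕₚ.m≤n⇒m≤1+n (proj₁ near)) (ℕₚ.m≤n⇒m≤1+n (proj₂ near))))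
              (optimal t {N} {insert r F} ℕₚ.≤-refl (λ {c} eq → insert-⊇ r F {c} (reg-step t eq)) confined-insert avoid))
    (solve 4 (λ s i a b → ((i :+ b) :+ s) :+ a := ((s :+ a) :+ i) :+ b) refl
      (score N (W t) F) (score N (W t) (insert r F)) (ω t r) (fromℕ 6))
    where
    N : ℕ
    N = suc (reach t)
    F : Region
    F = reg (suc t)
    r : Cell
    r = right (e (suc t))
    r∉ : F r ≡ false
    r∉ = right-outside {suc t} ℕₚ.≤-refl
    near : proj₁ r ℕ.< reach t × proj₂ r ℕ.< reach t
    near = right-reach {suc t} ℕₚ.≤-refl
    confined-insert : Confined (reach t) (insert r F)
    confined-insert {c} eq with insert-inv r F {c} eq
    ... | inj₁ refl = trans (cong (walls r ∨_) (cong₂ _∧_ (≤ᵇ-true (ℕₚ.<⇒≤ (proj₁ near))) (≤ᵇ-true (ℕₚ.<⇒≤ (proj₂ near))))) (∨-zeroʳ (walls r))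
    ... | inj₂ Fc   = confined′ t Fc
    avoid : ∀ {c} → c ∈ vis t → insert r F c ≡ false
    avoid {c} c∈ with sameCell r c in eq
    ... | true  = ⊥-elim (fresh (subst (_∈ vis t) (sym (sameCell-≡ {r} {c} eq)) c∈))
    ... | false = vis-outside′ t c∈

  -- 7 is 6, the perimeter bounding the weight when the cell was first chosen, plus 1 for the growth
  -- up to the revisit. The starting cell was never fresh, but it begins with no weight.
  light : ∀ t → ω t (right (e (suc t))) ≤ fromℕ 7
  light t with right (e (suc t)) ∈? vis t
  ... | no  fresh = ≤-trans (fresh-light t fresh) decide-≤
  ... | yes r∈ with first-visit t r∈
  ...   | i , i≤t , same-cell , first = subst (λ s → right (e i) ≡ right (e (suc s)) → ω s (right (e (suc s))) ≤ fromℕ 7)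
            (ℕₚ.m∸n+n≡m i≤t) (revisited (t ℕ.∸ i) i first′) same-cell
    where
    first′ : ∀ j → i ≡ suc j → right (e i) ∉ vis j
    first′ j eq r∈j = first j eq (subst (_∈ vis j) same-cell r∈j)
    revisited : ∀ m i → (∀ j → i ≡ suc j → right (e i) ∉ vis j) → right (e i) ≡ right (e (suc (m ℕ.+ i))) →
                ω (m ℕ.+ i) (right (e (suc (m ℕ.+ i)))) ≤ fromℕ 7
    revisited m zero first eq = combine
      (+-mono-≤ (+-mono-≤ (ω-later m 0 r) (≤-reflexive (initially r))) (+-mono-≤ (revisit-soon m 0 eq) (+-mono-≤ ε≥0 (decide-≤ {1ℚ} {fromℕ 7}))))
      (solve 4 (λ a b n ε → ((b :+ n :* ε) :+ con 0ℚ) :+ (con 1ℚ :+ (ε :+ con (fromℕ 7))) :+ a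
                            := ((a :+ b) :+ ((con 1ℚ :+ n) :* ε :+ (con 0ℚ :+ con 1ℚ))) :+ con (fromℕ 7)) refl (ω (m ℕ.+ 0) r) (ω 0 r) (fromℕ m) ε)
      where
      r : Cell
      r = right (e (suc (m ℕ.+ 0)))
    revisited m (suc i) first eq = combine
      (+-mono-≤ (+-mono-≤ (subst (λ s → ω s r ≤ ω i r + fromℕ (suc m) * ε) (sym (ℕₚ.+-suc m i)) (ω-later (suc m) i r))
                          (subst (λ c → ω i c ≤ fromℕ 6) eq (fresh-light i (first i refl))))
                (revisit-soon m (suc i) eq))
      (solve 3 (λ a b y → ((b :+ y) :+ con (fromℕ 6)) :+ con 1ℚ :+ a := ((a :+ b) :+ y) :+ con (fromℕ 7)) refl
        (ω (m ℕ.+ suc i) r) (ω i r) (fromℕ (suc m) * ε))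
      where
      r : Cell
      r = right (e (suc (m ℕ.+ suc i)))

-- Fading in distant weight

fromℕ-pos : ∀ n → Positive (fromℕ (suc n))
fromℕ-pos n = positive (<-≤-trans (from-yes (0ℚ <? 1ℚ)) (≤-trans (≤-reflexive (sym (+-identityʳ 1ℚ))) (+-monoʳ-≤ 1ℚ (0≤fromℕ n))))

abstract

  inv : ℕ → ℚ
  inv n = (1/ fromℕ (suc n)) {{pos⇒nonZero (fromℕ (suc n)) {{fromℕ-pos n}}}}

  inv-inverse : ∀ n → fromℕ (suc n) * inv n ≡ 1ℚ
  inv-inverse n = *-inverseʳ (fromℕ (suc n)) {{pos⇒nonZero (fromℕ (suc n)) {{fromℕ-pos n}}}}

  0<inv : ∀ n → 0ℚ < inv n
  0<inv n = positive⁻¹ (inv n) {{1/pos⇒pos (fromℕ (suc n)) {{fromℕ-pos n}}}}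

  0≤inv : ∀ n → 0ℚ ≤ inv n
  0≤inv n = <⇒≤ (0<inv n)

inv-antitone : ∀ {m n} → m ℕ.≤ n → inv n ≤ inv m
inv-antitone {m} {n} m≤n = begin
  inv n                             ≡⟨ sym (*-identityˡ (inv n)) ⟩
  1ℚ * inv n                        ≡⟨ cong (_* inv n) (sym (inv-inverse m)) ⟩
  (fromℕ (suc m) * inv m) * inv n   ≤⟨ *-mono-nonNeg (inv n) (0≤inv n) (*-mono-nonNeg (inv m) (0≤inv m) (fromℕ-mono (s≤s m≤n))) ⟩
  (fromℕ (suc n) * inv m) * inv n   ≡⟨ solve 3 (λ a b c → (a :* b) :* c := (a :* c) :* b) refl (fromℕ (suc n)) (inv m) (inv n) ⟩
  (fromℕ (suc n) * inv n) * inv m   ≡⟨ cong (_* inv m) (inv-inverse n) ⟩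
  1ℚ * inv m                        ≡⟨ *-identityˡ (inv m) ⟩
  inv m                             ∎
  where open ≤-Reasoning

-- Far weight is faded in linearly, from nothing when t is half the distance to everything when t reaches
-- the distance.  The fading adds at most 2 / (t + 1) times the total weight per turn.
visible : ℕ → ℕ → ℕ
visible t d = suc d ℕ.⊓ (reach t ℕ.∸ suc d)

fraction : ℕ → ℕ → ℚ
fraction t d = fromℕ (visible t d) * inv d

reach-suc : ∀ t → reach (suc t) ≡ 2 ℕ.+ reach t
reach-suc t = cong suc (ℕₚ.+-suc (t ℕ.+ 3) (t ℕ.+ 3))

0≤fraction : ∀ t d → 0ℚ ≤ fraction t d
0≤fraction t d = *-nonNeg (0≤fromℕ (visible t d)) (0≤inv d)

fraction≤1 : ∀ t d → fraction t d ≤ 1ℚ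
fraction≤1 t d = ≤-trans (*-mono-nonNeg (inv d) (0≤inv d) (fromℕ-mono (ℕₚ.m⊓n≤m (suc d) (reach t ℕ.∸ suc d)))) (≤-reflexive (inv-inverse d))

-- `suc (suc t)` bounds both coordinates of the cell entered at time `suc t`, so the weight there is
-- seen in full.
fraction-near : ∀ t d → d ℕ.≤ suc (suc t) → fraction t d ≡ 1ℚ
fraction-near t d d≤ = trans (cong (λ n → fromℕ n * inv d) (ℕₚ.m≤n⇒m⊓n≡m enough)) (inv-inverse d)
  where
  d< : suc d ℕ.≤ t ℕ.+ 3
  d< = ℕₚ.≤-trans (s≤s d≤) (ℕₚ.≤-reflexive (ℕₚ.+-comm 3 t))
  enough : suc d ℕ.≤ reach t ℕ.∸ suc d
  enough = ℕₚ.≤-trans d< (ℕₚ.≤-trans (ℕₚ.≤-reflexive (sym (ℕₚ.m+n∸n≡m (t ℕ.+ 3) (t ℕ.+ 3)))) (ℕₚ.∸-monoʳ-≤ (reach t) d<))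

fraction-far : ∀ t d → reach t ℕ.≤ d → fraction t d ≡ 0ℚ
fraction-far t d ≤d = trans (cong (λ n → fromℕ (suc d ℕ.⊓ n) * inv d) (ℕₚ.m≤n⇒m∸n≡0 (ℕₚ.m≤n⇒m≤1+n ≤d))) (*-zeroˡ (inv d))

fraction-mono : ∀ t d → fraction t d ≤ fraction (suc t) d
fraction-mono t d = *-mono-nonNeg (inv d) (0≤inv d) (fromℕ-mono (ℕₚ.⊓-monoʳ-≤ (suc d)
  (ℕₚ.∸-monoˡ-≤ (suc d) (ℕₚ.≤-trans (ℕₚ.m≤n+m (reach t) 2) (ℕₚ.≤-reflexive (sym (reach-suc t)))))))

-- `reach` grows by 2, so the fraction grows by at most `2 / (d + 1)`; for `d` up to `t + 2` it is
-- already 1, and beyond that `inv d ≤ inv t`.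
fraction-increment : ∀ t d → fraction (suc t) d ≤ fraction t d + fromℕ 2 * inv t
fraction-increment t d with d ℕ.≤? suc (suc t)
... | yes d≤ = ≤-trans (fraction≤1 (suc t) d) (≤-trans (≤-reflexive (sym (trans (+-identityʳ (fraction t d)) (fraction-near t d d≤))))
                 (+-monoʳ-≤ (fraction t d) (*-nonNeg (0≤fromℕ 2) (0≤inv t))))
... | no  d≰ = begin
  fromℕ (visible (suc t) d) * inv d              ≤⟨ *-mono-nonNeg (inv d) (0≤inv d) (fromℕ-mono grows) ⟩
  fromℕ (2 ℕ.+ visible t d) * inv d              ≡⟨ cong (_* inv d) (fromℕ-+ 2 (visible t d)) ⟩
  (fromℕ 2 + fromℕ (visible t d)) * inv d        ≡⟨ solve 3 (λ a b c → (a :+ b) :* c := b :* c :+ a :* c) refl (fromℕ 2) (fromℕ (visible t d)) (inv d) ⟩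
  fraction t d + fromℕ 2 * inv d                 ≤⟨ +-monoʳ-≤ (fraction t d) (*-monoˡ-≤-nonNeg (fromℕ 2) (inv-antitone t≤d)) ⟩
  fraction t d + fromℕ 2 * inv t                 ∎
  where
  open ≤-Reasoning
  t≤d : t ℕ.≤ d
  t≤d = ℕₚ.≤-trans (ℕₚ.m≤n+m t 2) (ℕₚ.<⇒≤ (ℕₚ.≰⇒> d≰))
  grows : visible (suc t) d ℕ.≤ 2 ℕ.+ visible t d
  grows = ℕₚ.≤-trans (ℕₚ.⊓-mono-≤ (ℕₚ.m≤n+m (suc d) 2) (ℕₚ.≤-trans (ℕₚ.≤-reflexive (cong (ℕ._∸ suc d) (reach-suc t))) (2+∸ (reach t) (suc d))))
    (ℕₚ.≤-reflexive (sym (ℕₚ.+-distribˡ-⊓ 2 (suc d) (reach t ℕ.∸ suc d))))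
    where
    2+∸ : ∀ a b → 2 ℕ.+ a ℕ.∸ b ℕ.≤ 2 ℕ.+ (a ℕ.∸ b)
    2+∸ a b = ℕₚ.m≤n+o⇒m∸n≤o (2 ℕ.+ a) b (ℕₚ.≤-trans (ℕₚ.+-monoʳ-≤ 2 (ℕₚ.m≤n+m∸n a b))
      (ℕₚ.≤-reflexive (trans (sym (ℕₚ.+-assoc 2 b (a ℕ.∸ b))) (trans (cong (ℕ._+ (a ℕ.∸ b)) (ℕₚ.+-comm 2 b)) (ℕₚ.+-assoc b 2 (a ℕ.∸ b))))))

distance : Cell → ℕ
distance (x , y) = x ℕ.⊔ y

-- The factor 24 makes a full cell weigh far more than its perimeter 6.
fade : ℕ → (Cell → ℚ) → Cell → ℚ
fade t m c = (m c * fraction t (distance c)) * fromℕ 24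

module Fading (m : ℕ → Cell → ℚ) (τ : ℚ)
  (initially : ∀ c → m 0 c ≡ 0ℚ)
  (growing   : ∀ t c → m t c ≤ m (suc t) c)
  (slowly    : ∀ t N → ∑ (window N) (λ u → spread (m (suc t)) u - spread (m t) u) ≤ τ)
  where

  ω : ℕ → Cell → ℚ
  ω t = fade t (m t)

  m≥0 : ∀ t c → 0ℚ ≤ m t c
  m≥0 zero    c = ≤-reflexive (sym (initially c))
  m≥0 (suc t) c = ≤-trans (m≥0 t c) (growing t c)

  total : ∀ t N → ∑ (window N) (spread (m t)) ≤ fromℕ t * τ
  total zero    N = ≤-reflexive (trans (∑-zero (window N) (λ {u} _ → spread-zero u (initially (lo u)))) (sym (*-zeroˡ τ)))
  total (suc t) N = combine (+-mono-≤ (total t N) (slowly t N))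
    (trans (solve 4 (λ n τ a b → (n :* τ :+ τ) :+ b := (a :+ (b :- a)) :+ (con 1ℚ :+ n) :* τ) refl (fromℕ t) τ (∑ (window N) (spread (m t))) (∑ (window N) (spread (m (suc t)))))
      (cong (λ z → (∑ (window N) (spread (m t)) + z) + fromℕ (suc t) * τ) (sym (∑-- (window N) (spread (m (suc t))) (spread (m t))))))

  -- 72 is 24 times 3: new weight contributes `τ`, and the fading at most the fraction `2 / (t + 1)`
  -- of a total not exceeding `t * τ`, that is, less than `2 τ` more when `τ` is positive.
  slow-growth : SlowGrowth ω (fromℕ 72 * τ)
  slow-growth = record
    { initially = λ c → trans (cong (λ z → (z * fraction 0 (distance c)) * fromℕ 24) (initially c))
                              (trans (cong (_* fromℕ 24) (*-zeroˡ (fraction 0 (distance c)))) (*-zeroˡ (fromℕ 24)))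
    ; growing   = λ t c → *-mono-nonNeg (fromℕ 24) (0≤fromℕ 24) (≤-trans (*-mono-nonNeg (fraction t (distance c)) (0≤fraction t (distance c)) (growing t c))
                    (*-monoˡ-≤-nonNeg (m (suc t) c) {{nonNegative (m≥0 (suc t) c)}} (fraction-mono t (distance c))))
    ; slowly    = slowly′
    ; supported = λ t c r< → trans (cong (λ z → (m t c * z) * fromℕ 24) (fraction-far t (distance c) (far-away t c r<)))
                              (trans (cong (_* fromℕ 24) (*-zeroʳ (m t c))) (*-zeroˡ (fromℕ 24)))
    }
    where
    far-away : ∀ t c → reach t ℕ.< proj₁ c ⊎ reach t ℕ.< proj₂ c → reach t ℕ.≤ distance c
    far-away t (x , y) (inj₁ r<) = ℕₚ.≤-trans (ℕₚ.<⇒≤ r<) (ℕₚ.m≤m⊔n x y)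
    far-away t (x , y) (inj₂ r<) = ℕₚ.≤-trans (ℕₚ.<⇒≤ r<) (ℕₚ.m≤n⊔m x y)
    -- The product rule: new weight is counted in full, old weight times the growth of its fraction.
    increment : ∀ t c → ω (suc t) c - ω t c ≤ ((m (suc t) c - m t c) + m t c * (fromℕ 2 * inv t)) * fromℕ 24
    increment t c = ≤-trans (≤-reflexive (solve 3 (λ a b k → a :* k :- b :* k := (a :- b) :* k) refl (m (suc t) c * f′) (m t c * f) (fromℕ 24)))
      (*-mono-nonNeg (fromℕ 24) (0≤fromℕ 24) (combine
        (+-mono-≤ (*-mono-nonNeg (m (suc t) c - m t c) (0≤-diff (growing t c)) (fraction≤1 (suc t) (distance c)))
                  (*-mono-nonNeg (m t c) (m≥0 t c) (fraction-increment t (distance c))))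
        (solve 5 (λ a b f f′ j → (con 1ℚ :* (a :- b) :+ (f :+ j) :* b) :+ (a :* f′ :- b :* f) :=
                                 (f′ :* (a :- b) :+ f′ :* b) :+ ((a :- b) :+ b :* j)) refl (m (suc t) c) (m t c) f f′ (fromℕ 2 * inv t))))
      where
      f f′ : ℚ
      f = fraction t (distance c)
      f′ = fraction (suc t) (distance c)
    pointwise : ∀ t u → spread (ω (suc t)) u - spread (ω t) u ≤
                        ((spread (m (suc t)) u - spread (m t) u) + spread (m t) u * (fromℕ 2 * inv t)) * fromℕ 24
    pointwise t (h , c) = increment t c
    pointwise t (v , c) = ≤-reflexive (solve 1 (λ j → con 0ℚ :- con 0ℚ := ((con 0ℚ :- con 0ℚ) :+ con 0ℚ :* j) :* con (fromℕ 24)) refl (fromℕ 2 * inv t))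
    pointwise t (g , c) = ≤-reflexive (solve 1 (λ j → con 0ℚ :- con 0ℚ := ((con 0ℚ :- con 0ℚ) :+ con 0ℚ :* j) :* con (fromℕ 24)) refl (fromℕ 2 * inv t))
    0≤τ : 0ℚ ≤ τ
    -- `window 0` is empty, so the sum is `0ℚ`.
    0≤τ = slowly 0 0
    slowly′ : ∀ t N → ∑ (window N) (λ u → spread (ω (suc t)) u - spread (ω t) u) ≤ fromℕ 72 * τ
    slowly′ t N = begin
      ∑ (window N) (λ u → spread (ω (suc t)) u - spread (ω t) u)
        ≤⟨ ∑-mono (window N) (pointwise t) ⟩
      ∑ (window N) (λ u → (Δ u + spread (m t) u * j) * fromℕ 24)
        ≡⟨ ∑-*ʳ (window N) (λ u → Δ u + spread (m t) u * j) (fromℕ 24) ⟩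
      ∑ (window N) (λ u → Δ u + spread (m t) u * j) * fromℕ 24
        ≡⟨ cong (_* fromℕ 24) (trans (∑-+ (window N) Δ (λ u → spread (m t) u * j)) (cong (∑ (window N) Δ +_) (∑-*ʳ (window N) (spread (m t)) j))) ⟩
      (∑ (window N) Δ + ∑ (window N) (spread (m t)) * j) * fromℕ 24
        ≤⟨ *-mono-nonNeg (fromℕ 24) (0≤fromℕ 24) (+-mono-≤ (slowly t N) (*-mono-nonNeg j 0≤j (≤-trans (total t N) (*-mono-nonNeg τ 0≤τ (fromℕ-mono (ℕₚ.n≤1+n t)))))) ⟩
      (τ + (fromℕ (suc t) * τ) * j) * fromℕ 24
        ≡⟨ solve 3 (λ τ n i → (τ :+ (n :* τ) :* (con (fromℕ 2) :* i)) :* con (fromℕ 24) := (τ :+ ((n :* i) :* τ) :* con (fromℕ 2)) :* con (fromℕ 24)) refl τ (fromℕ (suc t)) (inv t) ⟩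
      (τ + ((fromℕ (suc t) * inv t) * τ) * fromℕ 2) * fromℕ 24
        ≡⟨ cong (λ z → (τ + (z * τ) * fromℕ 2) * fromℕ 24) (inv-inverse t) ⟩
      (τ + (1ℚ * τ) * fromℕ 2) * fromℕ 24
        ≡⟨ solve 1 (λ τ → (τ :+ (con 1ℚ :* τ) :* con (fromℕ 2)) :* con (fromℕ 24) := con (fromℕ 72) :* τ) refl τ ⟩
      fromℕ 72 * τ ∎
      where
      open ≤-Reasoning
      Δ : Side → ℚ
      Δ u = spread (m (suc t)) u - spread (m t) u
      j : ℚ
      j = fromℕ 2 * inv t
      0≤j : 0ℚ ≤ j
      0≤j = *-nonNeg (0≤fromℕ 2) (0≤inv t)

  module _ (small : fromℕ 25 * (fromℕ 72 * τ) ≤ 1ℚ) where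

    open Walk ω
    open Survival slow-growth small using (light)

    -- `7 / 24` is rounded up to `½`; the other half is reserved for what is added while the step is
    -- carried out.
    safe : ∀ t → m t (right (e (suc t))) ≤ ½
    safe t = *-cancelʳ-≤-pos (fromℕ 24) (begin
      m t r * fromℕ 24 ≡⟨ cong (_* fromℕ 24) (sym (*-identityʳ (m t r))) ⟩
      (m t r * 1ℚ) * fromℕ 24 ≡⟨ cong (λ z → (m t r * z) * fromℕ 24) (sym (fraction-near t (distance r) near)) ⟩
      ω t r ≤⟨ light t ⟩
      fromℕ 7 ≤⟨ decide-≤ ⟩
      ½ * fromℕ 24 ∎)
      where
      open ≤-Reasoning
      r : Cell
      r = right (e (suc t))
      near : distance r ℕ.≤ suc (suc t)
      near = ℕₚ.⊔-lub (proj₁ (right-bound (suc t))) (proj₂ (right-bound (suc t)))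

-- Bricks as pairs of squares of the board

open State

-- Cells are the bricks of a running bond: the hexagonal neighbours of a brick are the bricks sharing a side with it.
square : ℕ → ℕ → ℕ → Pos
square a b y = ⁺ a ℤ.- ⁺ b , ⁺ y ℤ.- ⁺ 1

-- Each row of bricks is shifted by one square against the row below, so that the six directions of
-- `nb` lead to touching bricks. The offsets put `home (1 , 1)` at the origin.
home second : Cell → Pos
home   (x , y) = square (x ℕ.+ x) (suc y) y
second (x , y) = square (x ℕ.+ x) y y

brick : Weight → Cell → ℚ
brick f c = f (home c) + f (second c)

difference : ∀ a b c d → (⁺ a ℤ.- ⁺ b) ℤ.- (⁺ c ℤ.- ⁺ d) ≡ (a ℕ.+ d) ⊖ (c ℕ.+ b)
difference a b c d = trans (rearrange (⁺ a) (⁺ b) (⁺ c) (⁺ d))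
  (trans (cong₂ ℤ._-_ (sym (ℤₚ.pos-+ a d)) (sym (ℤₚ.pos-+ c b))) (ℤₚ.[+m]-[+n]≡m⊖n (a ℕ.+ d) (c ℕ.+ b)))
  where
  open ℤSolver.+-*-Solver renaming (solve to solveᶻ; _:=_ to _⊜ᶻ_; _:+_ to _⊕ᶻ_; _:-_ to _⊝ᶻ_)
  rearrange : ∀ a b c d → (a ℤ.- b) ℤ.- (c ℤ.- d) ≡ (a ℤ.+ d) ℤ.- (c ℤ.+ b)
  rearrange = solveᶻ 4 (λ a b c d → (a ⊝ᶻ b) ⊝ᶻ (c ⊝ᶻ d) ⊜ᶻ (a ⊕ᶻ d) ⊝ᶻ (c ⊕ᶻ b)) refl

Gap : ℕ → ℕ → Set
Gap m n = m ≡ suc n ⊎ n ≡ suc m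

gap : ∀ {m n} → Gap m n → ℤ.∣ m ⊖ n ∣ ≡ 1
gap {n = n} (inj₁ refl) = above n
  where
  above : ∀ n → ℤ.∣ suc n ⊖ n ∣ ≡ 1
  above zero    = refl
  above (suc n) = trans (cong ℤ.∣_∣ (ℤₚ.[1+m]⊖[1+n]≡m⊖n (suc n) n)) (above n)
gap {m = m} (inj₂ refl) = below m
  where
  below : ∀ n → ℤ.∣ n ⊖ suc n ∣ ≡ 1
  below zero    = refl
  below (suc n) = trans (cong ℤ.∣_∣ (ℤₚ.[1+m]⊖[1+n]≡m⊖n n (suc n))) (below n)

no-gap : ∀ {m n} → m ≡ n → ℤ.∣ m ⊖ n ∣ ≡ 0
no-gap {m} refl = cong ℤ.∣_∣ (ℤₚ.n⊖n≡0 m)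

dist-square : ∀ a b y a′ b′ y′ → dist (square a b y) (square a′ b′ y′) ≡ ℤ.∣ (a ℕ.+ b′) ⊖ (a′ ℕ.+ b) ∣ ℕ.+ ℤ.∣ (y ℕ.+ 1) ⊖ (y′ ℕ.+ 1) ∣
dist-square a b y a′ b′ y′ = cong₂ (λ p q → ℤ.∣ p ∣ ℕ.+ ℤ.∣ q ∣) (difference a b a′ b′) (difference y 1 y′ 1)

dist-horizontal : ∀ a b a′ b′ y → Gap (a ℕ.+ b′) (a′ ℕ.+ b) → dist (square a b y) (square a′ b′ y) ℕ.≤ 1
dist-horizontal a b a′ b′ y eq = ℕₚ.≤-reflexive (trans (dist-square a b y a′ b′ y) (cong₂ ℕ._+_ (gap eq) (no-gap {y ℕ.+ 1} refl)))

dist-vertical : ∀ a b y a′ b′ y′ → a ℕ.+ b′ ≡ a′ ℕ.+ b → Gap (y ℕ.+ 1) (y′ ℕ.+ 1) → dist (square a b y) (square a′ b′ y′) ℕ.≤ 1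
dist-vertical a b y a′ b′ y′ eq eq′ = ℕₚ.≤-reflexive (trans (dist-square a b y a′ b′ y′) (cong₂ ℕ._+_ (no-gap eq) (gap eq′)))

dist-refl : ∀ p → dist p p ℕ.≤ 1
dist-refl (x , y) = subst (ℕ._≤ 1) (sym (cong₂ (λ a b → ℤ.∣ a ∣ ℕ.+ ℤ.∣ b ∣) (ℤₚ.+-inverseʳ x) (ℤₚ.+-inverseʳ y))) z≤n

home-second : ∀ c → dist (home c) (second c) ℕ.≤ 1
home-second (x , y) = dist-horizontal (x ℕ.+ x) (suc y) (x ℕ.+ x) y y (inj₂ (ℕₚ.+-suc (x ℕ.+ x) y))

second-home : ∀ c → dist (second c) (home c) ℕ.≤ 1
second-home (x , y) = dist-horizontal (x ℕ.+ x) y (x ℕ.+ x) (suc y) y (inj₁ (ℕₚ.+-suc (x ℕ.+ x) y))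

-- The way from `home` to the `home` of a neighbouring brick passes through exactly one `second`
-- square; this is the brick that contains it.
via : Dir → Cell → Cell
via east      r = r
via northeast r = r
via north     r = nb north r
via west      r = nb west r
via southwest r = nb southwest r
via south     r = r

via-from : ∀ d {r} → Interior r → dist (home r) (second (via d r)) ℕ.≤ 1
via-from east      {r} _ = home-second r
via-from northeast {r} _ = home-second r
via-from south     {r} _ = home-second r
via-from north     (interior {x} {y}) = dist-vertical (suc x ℕ.+ suc x) (suc (suc y)) (suc y) (suc x ℕ.+ suc x) (suc (suc y)) (suc (suc y)) refl (inj₂ refl)
via-from west      (interior {x} {y}) = dist-horizontal (suc x ℕ.+ suc x) (suc (suc y)) (x ℕ.+ x) (suc y) (suc y) (inj₁ (eq x y))
  where
  eq : ∀ x y → (suc x ℕ.+ suc x) ℕ.+ suc y ≡ suc ((x ℕ.+ x) ℕ.+ suc (suc y))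
  eq = solve-∀
via-from southwest (interior {x} {y}) = dist-vertical (suc x ℕ.+ suc x) (suc (suc y)) (suc y) (x ℕ.+ x) y y (eq x y) (inj₁ refl)
  where
  eq : ∀ x y → (suc x ℕ.+ suc x) ℕ.+ y ≡ (x ℕ.+ x) ℕ.+ suc (suc y)
  eq = solve-∀

via-to : ∀ d {r} → Interior r → dist (second (via d r)) (home (nb d r)) ℕ.≤ 1
via-to north     {r} _ = second-home (nb north r)
via-to west      {r} _ = second-home (nb west r)
via-to southwest {r} _ = second-home (nb southwest r)
via-to east      (interior {x} {y}) = dist-horizontal (suc x ℕ.+ suc x) (suc y) (suc (suc x) ℕ.+ suc (suc x)) (suc (suc y)) (suc y) (inj₂ (eq x y))
  where
  eq : ∀ x y → (suc (suc x) ℕ.+ suc (suc x)) ℕ.+ suc y ≡ suc ((suc x ℕ.+ suc x) ℕ.+ suc (suc y))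
  eq = solve-∀
via-to northeast (interior {x} {y}) = dist-vertical (suc x ℕ.+ suc x) (suc y) (suc y) (suc (suc x) ℕ.+ suc (suc x)) (suc (suc (suc y))) (suc (suc y)) (eq x y) (inj₂ refl)
  where
  eq : ∀ x y → (suc x ℕ.+ suc x) ℕ.+ suc (suc (suc y)) ≡ (suc (suc x) ℕ.+ suc (suc x)) ℕ.+ suc y
  eq = solve-∀
via-to south     (interior {x} {y}) = dist-vertical (suc x ℕ.+ suc x) (suc y) (suc y) (suc x ℕ.+ suc x) (suc y) y refl (inj₁ refl)

double-injective : ∀ x y → x ℕ.+ x ≡ y ℕ.+ y → x ≡ y
double-injective zero    zero    _  = refl
double-injective (suc x) (suc y) eq = cong suc (double-injective x y
  (ℕₚ.suc-injective (trans (sym (ℕₚ.+-suc x x)) (trans (ℕₚ.suc-injective eq) (ℕₚ.+-suc y y)))))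

double≢odd : ∀ x y → x ℕ.+ x ≢ suc (y ℕ.+ y)
double≢odd (suc x) (suc y) eq = double≢odd x y
  (ℕₚ.suc-injective (trans (sym (ℕₚ.+-suc x x)) (trans (ℕₚ.suc-injective eq) (cong suc (ℕₚ.+-suc y y)))))
double≢odd (suc x) zero    eq with () ← trans (sym (ℕₚ.+-suc x x)) (ℕₚ.suc-injective eq)

⊖-zero : ∀ {m n} → m ⊖ n ≡ ⁺ 0 → m ≡ n
⊖-zero {zero}  {zero}  _  = refl
⊖-zero {suc m} {suc n} eq = cong suc (⊖-zero (trans (sym (ℤₚ.[1+m]⊖[1+n]≡m⊖n m n)) eq))

difference-injective : ∀ a b c d → ⁺ a ℤ.- ⁺ b ≡ ⁺ c ℤ.- ⁺ d → a ℕ.+ d ≡ c ℕ.+ b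
difference-injective a b c d eq = ⊖-zero (trans (sym (difference a b c d)) (trans (cong (ℤ._- (⁺ c ℤ.- ⁺ d)) eq) (ℤₚ.+-inverseʳ (⁺ c ℤ.- ⁺ d))))

square-injective : ∀ {a b y a′ b′ y′} → square a b y ≡ square a′ b′ y′ → a ℕ.+ b′ ≡ a′ ℕ.+ b × y ≡ y′
square-injective {a} {b} {y} {a′} {b′} {y′} eq = difference-injective a b a′ b′ (cong proj₁ eq) ,
  ℕₚ.+-cancelʳ-≡ 1 y y′ (difference-injective y 1 y′ 1 (cong proj₂ eq))

home-injective : ∀ {c c′} → home c ≡ home c′ → c ≡ c′
home-injective {x , y} {x′ , y′} eq with square-injective {x ℕ.+ x} {suc y} {y} {x′ ℕ.+ x′} {suc y′} {y′} eq
... | eq′ , refl = cong (_, y) (double-injective x x′ (ℕₚ.+-cancelʳ-≡ (suc y) (x ℕ.+ x) (x′ ℕ.+ x′) eq′))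

second-injective : ∀ {c c′} → second c ≡ second c′ → c ≡ c′
second-injective {x , y} {x′ , y′} eq with square-injective {x ℕ.+ x} {y} {y} {x′ ℕ.+ x′} {y′} {y′} eq
... | eq′ , refl = cong (_, y) (double-injective x x′ (ℕₚ.+-cancelʳ-≡ y (x ℕ.+ x) (x′ ℕ.+ x′) eq′))

home≢second : ∀ c c′ → home c ≢ second c′
home≢second (x , y) (x′ , y′) eq with square-injective {x ℕ.+ x} {suc y} {y} {x′ ℕ.+ x′} {y′} {y′} eq
... | eq′ , refl = double≢odd x x′ (ℕₚ.+-cancelʳ-≡ y (x ℕ.+ x) (suc (x′ ℕ.+ x′)) (trans eq′ (ℕₚ.+-suc (x′ ℕ.+ x′) y)))

∈-range : ∀ N a b → a ℕ.≤ N → b ℕ.≤ N → (⁺ a ℤ.- ⁺ b) ∈ range N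
∈-range N a b a≤N b≤N = subst (_∈ range N) (sym shifted) (∈-map⁺ (λ i → ⁺ i ℤ.- ⁺ N) (∈-upTo⁺ bound))
  where
  i : ℕ
  i = a ℕ.+ (N ℕ.∸ b)
  bound : i ℕ.< suc (2 ℕ.* N)
  bound = s≤s (ℕₚ.+-mono-≤ a≤N (ℕₚ.≤-trans (ℕₚ.m∸n≤m N b) (ℕₚ.≤-reflexive (sym (ℕₚ.+-identityʳ N)))))
  shifted : ⁺ a ℤ.- ⁺ b ≡ ⁺ i ℤ.- ⁺ N
  shifted = ℤₚ.i-j≡0⇒i≡j _ _ (trans (difference a b i N) (trans (cong₂ _⊖_ refl agree) (ℤₚ.n⊖n≡0 (a ℕ.+ N))))
    where
    agree : i ℕ.+ b ≡ a ℕ.+ N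
    agree = trans (ℕₚ.+-assoc a (N ℕ.∸ b) b) (cong (a ℕ.+_) (ℕₚ.m∸n+n≡m b≤N))

∈-box : ∀ N {p} → proj₁ p ∈ range N → proj₂ p ∈ range N → p ∈ box N
∈-box N {x , y} x∈ y∈ = ∈-concatMap⁺ (λ x → map (x ,_) (range N)) {xs = range N} (go x∈)
  where
  go : ∀ {zs} → x ∈ zs → Any (λ z → (x , y) ∈ map (z ,_) (range N)) zs
  go (here refl) = here (∈-map⁺ (x ,_) y∈)
  go (there z∈)  = there (go z∈)

module _ (f : Weight) (f≥0 : ∀ p → 0ℚ ≤ f p) where

  private
    cells : ℕ → List Cell
    cells N = cartesianProduct (upTo N) (upTo N)

    squares : ℕ → List Pos
    squares N = map home (cells N) ++ map second (cells N)

    cells-unique : ∀ N → Unique (cells N)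
    cells-unique N = Uniqueₚ.cartesianProduct⁺ (Uniqueₚ.upTo⁺ N) (Uniqueₚ.upTo⁺ N)

    squares-unique : ∀ N → Unique (squares N)
    squares-unique N = Uniqueₚ.++⁺ (Uniqueₚ.map⁺ home-injective (cells-unique N)) (Uniqueₚ.map⁺ second-injective (cells-unique N)) disjoint
      where
      disjoint : ∀ {p} → ¬ (p ∈ map home (cells N) × p ∈ map second (cells N))
      disjoint (p∈ , p∈′) with ∈-map⁻ home p∈ | ∈-map⁻ second p∈′
      ... | c , _ , refl | c′ , _ , eq = home≢second c c′ eq

    wide : ℕ → ℕ
    wide N = suc (N ℕ.+ N)

    cell-bounds : ∀ N x y → (x , y) ∈ cells N → x ℕ.+ x ℕ.≤ wide N × suc y ℕ.≤ wide N
    cell-bounds N x y c∈ with ∈-cartesianProduct⁻ (upTo N) (upTo N) c∈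
    ... | x∈ , y∈ = ℕₚ.m≤n⇒m≤1+n (ℕₚ.+-mono-≤ (ℕₚ.<⇒≤ (∈-upTo⁻ x∈)) (ℕₚ.<⇒≤ (∈-upTo⁻ x∈))) ,
                    s≤s (ℕₚ.≤-trans (ℕₚ.<⇒≤ (∈-upTo⁻ y∈)) (ℕₚ.m≤m+n N N))

    squares-box : ∀ N {p} → p ∈ squares N → p ∈ box (wide N)
    squares-box N p∈ with ∈-++⁻ (map home (cells N)) p∈
    ... | inj₁ p∈′ with ∈-map⁻ home p∈′
    ...   | (x , y) , c∈ , refl with cell-bounds N x y c∈
    ...     | x≤ , y< = ∈-box (wide N) (∈-range (wide N) (x ℕ.+ x) (suc y) x≤ y<) (∈-range (wide N) y 1 (ℕₚ.<⇒≤ y<) (s≤s z≤n))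
    squares-box N p∈ | inj₂ p∈′ with ∈-map⁻ second p∈′
    ...   | (x , y) , c∈ , refl with cell-bounds N x y c∈
    ...     | x≤ , y< = ∈-box (wide N) (∈-range (wide N) (x ℕ.+ x) y x≤ (ℕₚ.<⇒≤ y<)) (∈-range (wide N) y 1 (ℕₚ.<⇒≤ y<) (s≤s z≤n))

    window-cells : ∀ N (ω : Cell → ℚ) → ∑ (window N) (spread ω) ≡ ∑ (cells N) ω
    window-cells N ω = begin
      ∑ (map (h ,_) (cells N) ++ map (v ,_) (cells N) ++ map (g ,_) (cells N) ++ []) (spread ω)
        ≡⟨ ∑-++ (map (h ,_) (cells N)) _ (spread ω) ⟩
      ∑ (map (h ,_) (cells N)) (spread ω) + ∑ (map (v ,_) (cells N) ++ map (g ,_) (cells N) ++ []) (spread ω)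
        ≡⟨ cong₂ _+_ (∑-map (cells N) (h ,_) (spread ω)) (∑-zero (map (v ,_) (cells N) ++ map (g ,_) (cells N) ++ []) (λ u∈ → weightless u∈)) ⟩
      ∑ (cells N) ω + 0ℚ
        ≡⟨ +-identityʳ (∑ (cells N) ω) ⟩
      ∑ (cells N) ω ∎
      where
      open ≡-Reasoning
      weightless : ∀ {u} → u ∈ map (v ,_) (cells N) ++ map (g ,_) (cells N) ++ [] → spread ω u ≡ 0ℚ
      weightless u∈ with ∈-++⁻ (map (v ,_) (cells N)) u∈
      ... | inj₁ u∈v with ∈-map⁻ (v ,_) u∈v
      ...   | _ , _ , refl = refl
      weightless u∈ | inj₂ u∈′ with ∈-++⁻ (map (g ,_) (cells N)) u∈′
      ... | inj₁ u∈g with ∈-map⁻ (g ,_) u∈g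
      ...   | _ , _ , refl = refl

  -- Different cells have disjoint bricks, so the sum runs over distinct squares, all in one box.
  brick-sum : ∀ {σ} → (∀ N → boxSum f N ≤ σ) → ∀ N → ∑ (window N) (spread (brick f)) ≤ σ
  brick-sum {σ} budget N = begin
    ∑ (window N) (spread (brick f))                              ≡⟨ window-cells N (brick f) ⟩
    ∑ (cells N) (brick f)                                        ≡⟨ ∑-+ (cells N) (λ c → f (home c)) (λ c → f (second c)) ⟩
    ∑ (cells N) (λ c → f (home c)) + ∑ (cells N) (λ c → f (second c)) ≡⟨ cong₂ _+_ (sym (∑-map (cells N) home f)) (sym (∑-map (cells N) second f)) ⟩
    ∑ (map home (cells N)) f + ∑ (map second (cells N)) f        ≡⟨ sym (∑-++ (map home (cells N)) (map second (cells N)) f) ⟩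
    ∑ (squares N) f                                              ≤⟨ ∑-embed {xs = squares N} {ys = box (wide N)} {f = f} (squares-unique N) f≥0 (λ p∈ → inj₁ (squares-box N p∈)) ⟩
    boxSum f (wide N)                                            ≤⟨ budget (wide N) ⟩
    σ                                                            ∎
    where open ≤-Reasoning

  brick-increment : ∀ {σ} → (∀ N → boxSum f N ≤ σ) → ∀ c → brick f c ≤ σ
  brick-increment {σ} budget c@(x , y) = ≤-trans single (brick-sum budget (suc (x ℕ.+ y)))
    where
    spread≥0 : ∀ u → 0ℚ ≤ spread (brick f) u
    spread≥0 (h , c) = +-mono-≤ (f≥0 (home c)) (f≥0 (second c))
    spread≥0 (v , c) = ≤-refl
    spread≥0 (g , c) = ≤-refl
    single : brick f c ≤ ∑ (window (suc (x ℕ.+ y))) (spread (brick f))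
    single = ≤-trans (≤-reflexive (sym (+-identityʳ (brick f c))))
      (∑-embed {xs = (h , c) ∷ []} {f = spread (brick f)} ([] ∷ []) spread≥0
        (λ { (here refl) → inj₁ (∈-window h (s≤s (ℕₚ.m≤m+n x y)) (s≤s (ℕₚ.m≤n+m y x))) }))

-- Strategy

-- A history begins with the weight after the first turn, so its entries are counted from 1 and
-- index 0 is the empty board.
at : List Weight → ℕ → Weight
at l       zero          = λ _ → 0ℚ
at []      (suc n)       = λ _ → 0ℚ
at (w ∷ l) (suc zero)    = w
at (w ∷ l) (suc (suc n)) = at l (suc n)

faded : (ℕ → Weight) → ℕ → Cell → ℚ
faded f t = fade t (brick (f (t ℕ.+ t)))

middle : Region → Edge → Pos
middle F e = if F (left (turn e)) then home (right e) else second (via (cw (proj₂ e)) (right e))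

-- A step of the walk along the bricks takes two turns; n counts turns after the t-th step.
trajectory : (ℕ → Weight) → ℕ → ℕ → Pos
trajectory f t zero          = home (right (edge (play (faded f) t)))
trajectory f t (suc zero)    = middle (region (play (faded f) (suc t))) (edge (play (faded f) t))
trajectory f t (suc (suc n)) = trajectory f (suc t) n

strategy : AngelStrategy
strategy l = trajectory (at l) 0 (length l)

play-cong : ∀ {ω ω′ : ℕ → Cell → ℚ} t → (∀ s → s ℕ.< t → ω s ≡ ω′ s) → play ω t ≡ play ω′ t
play-cong zero    eq = refl
play-cong (suc t) eq = cong₂ (extend t) (eq t ℕₚ.≤-refl) (play-cong t (λ s s<t → eq s (ℕₚ.m≤n⇒m≤1+n s<t)))

-- Causality: the position after `t + t + n` turns depends only on weights up to that turn, so a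
-- finite history determines it.
trajectory-cong : ∀ {f f′ : ℕ → Weight} t n → (∀ k → k ℕ.≤ t ℕ.+ t ℕ.+ n → f k ≡ f′ k) → trajectory f t n ≡ trajectory f′ t n
trajectory-cong {f} {f′} t zero eq = cong (λ s → home (right (edge s))) (play-cong t (λ s s<t → cong (λ w → fade s (brick w)) (eq (s ℕ.+ s)
  (ℕₚ.≤-trans (ℕₚ.+-mono-≤ (ℕₚ.<⇒≤ s<t) (ℕₚ.<⇒≤ s<t)) (ℕₚ.m≤m+n (t ℕ.+ t) 0)))))
trajectory-cong {f} {f′} t (suc zero) eq = cong₂ (λ s s′ → middle (region s) (edge s′)) (same-play (suc t) (λ s s<t → ℕₚ.≤-pred s<t)) (same-play t (λ s s<t → ℕₚ.<⇒≤ s<t))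
  where
  same-play : ∀ n → (∀ s → s ℕ.< n → s ℕ.≤ t) → play (faded f) n ≡ play (faded f′) n
  same-play n early = play-cong n (λ s s<n → cong (λ w → fade s (brick w)) (eq (s ℕ.+ s)
    (ℕₚ.≤-trans (ℕₚ.+-mono-≤ (early s s<n) (early s s<n)) (ℕₚ.m≤m+n (t ℕ.+ t) 1))))
trajectory-cong t (suc (suc n)) eq = trajectory-cong (suc t) n (λ k k≤ → eq k (ℕₚ.≤-trans k≤ (ℕₚ.≤-reflexive (shift t n))))
  where
  shift : ∀ t n → suc t ℕ.+ suc t ℕ.+ n ≡ t ℕ.+ t ℕ.+ suc (suc n)
  shift = solve-∀

-- `μ 0` vanishes only pointwise. Putting the zero function itself there makes the agreement with
-- `at` an equality of functions, as `play-cong` demands.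
trace : (ℕ → Weight) → ℕ → Weight
trace μ zero    = λ _ → 0ℚ
trace μ (suc n) = μ (suc n)

at-history : ∀ μ n k → k ℕ.≤ n → at (history μ n) k ≡ trace μ k
at-history μ n zero    _   = refl
at-history μ n (suc k) k<n = at-upTo (λ i → i) n k k<n
  where
  at-upTo : ∀ (i : ℕ → ℕ) n k → k ℕ.< n → at (map (λ i → μ (suc i)) (applyUpTo i n)) (suc k) ≡ μ (suc (i k))
  at-upTo i (suc n) zero    _         = refl
  at-upTo i (suc n) (suc k) (s≤s k<n) = at-upTo (λ j → i (suc j)) n k k<n

length-history : ∀ μ n → length (history μ n) ≡ n
length-history μ n = trans (length-map (λ i → μ (suc i)) (upTo n)) (length-upTo n)

position-strategy : ∀ μ n → position strategy μ n ≡ trajectory (trace μ) 0 n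
position-strategy μ n = trans (cong (trajectory (at (history μ n)) 0) (length-history μ n))
                              (trajectory-cong 0 n (at-history μ n))

via-brick : ∀ d r → via d r ≡ r ⊎ via d r ≡ nb d r
via-brick east      r = inj₁ refl
via-brick northeast r = inj₁ refl
via-brick north     r = inj₂ refl
via-brick west      r = inj₂ refl
via-brick southwest r = inj₂ refl
via-brick south     r = inj₁ refl

middle-on : ∀ F e → Interior (right e) →
            dist (home (right e)) (middle F e) ℕ.≤ 1 × dist (middle F e) (home (right (next F e))) ℕ.≤ 1 ×
            ∃ λ c → (c ≡ right e ⊎ c ≡ right (next F e)) × (middle F e ≡ home c ⊎ middle F e ≡ second c)
middle-on F e@(r , d) int with F (left (turn e))
... | true  = dist-refl (home r) , dist-refl (home r) , r , inj₁ refl , inj₁ refl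
... | false = via-from (cw d) int , via-to (cw d) int , via (cw d) r , via-brick (cw d) r , inj₂ refl

-- The strategy against a legal play of the devil

-- `1 / 3600`, where 3600 is 25 from the loop bound, times 72 from the fading, times the 2 turns per
-- step of the walk.
threshold : ℚ
threshold = inv 59 * inv 59

small-budget : ∀ {σ} → σ ≤ threshold → fromℕ 25 * (fromℕ 72 * (σ + σ)) ≤ 1ℚ
small-budget {σ} σ≤threshold = begin
  fromℕ 25 * (fromℕ 72 * (σ + σ)) ≡⟨ solve 1 (λ s → con (fromℕ 25) :* (con (fromℕ 72) :* (s :+ s)) := (s :* con (fromℕ 60)) :* con (fromℕ 60)) refl σ ⟩
  (σ * fromℕ 60) * fromℕ 60       ≤⟨ *-mono-nonNeg (fromℕ 60) (0≤fromℕ 60) (*-mono-nonNeg (fromℕ 60) (0≤fromℕ 60) σ≤threshold) ⟩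
  (threshold * fromℕ 60) * fromℕ 60      ≡⟨ cancel (fromℕ 60) (inv 59) (inv-inverse 59) ⟩
  1ℚ                              ∎
  where
  open ≤-Reasoning
  cancel : ∀ n i → n * i ≡ 1ℚ → ((i * i) * n) * n ≡ 1ℚ
  cancel n i eq = trans (solve 2 (λ i n → ((i :* i) :* n) :* n := (n :* i) :* (n :* i)) refl i n) (cong₂ _*_ eq eq)

module _ {σ : ℚ} (small : fromℕ 25 * (fromℕ 72 * (σ + σ)) ≤ 1ℚ) {μ : ℕ → Weight} (devil : DevilPlay σ μ) where

  open DevilPlay devil

  private
    f : ℕ → Weight
    f = trace μ

    f≡μ : ∀ t p → f t p ≡ μ t p
    f≡μ zero    p = sym (start p)
    f≡μ (suc t) p = refl

    Δ : ℕ → Weight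
    Δ t p = f (suc t) p - f t p

    f-mono : ∀ t p → f t p ≤ f (suc t) p
    f-mono t p = subst (_≤ μ (suc t) p) (sym (f≡μ t p)) (monotone t p)

    Δ≥0 : ∀ t p → 0ℚ ≤ Δ t p
    Δ≥0 t p = 0≤-diff (f-mono t p)

    Δ-budget : ∀ t N → boxSum (Δ t) N ≤ σ
    Δ-budget t N = subst (_≤ σ) (∑-cong (box N) (λ {p} _ → cong (λ z → μ (suc t) p - z) (sym (f≡μ t p)))) (budget t N)

    m : ℕ → Cell → ℚ
    m t = brick (f (t ℕ.+ t))

    m-step : ∀ t c → m (suc t) c - m t c ≡ brick (Δ (t ℕ.+ t)) c + brick (Δ (suc (t ℕ.+ t))) c
    m-step t c = trans (cong (λ s → brick (f (suc s)) c - m t c) (ℕₚ.+-suc t t))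
      (solve 6 (λ a b c d e f → (a :+ b) :- (c :+ d) := ((e :- c) :+ (f :- d)) :+ ((a :- e) :+ (b :- f))) refl
        (f (suc (suc (t ℕ.+ t))) (home c)) (f (suc (suc (t ℕ.+ t))) (second c)) (f (t ℕ.+ t) (home c)) (f (t ℕ.+ t) (second c))
        (f (suc (t ℕ.+ t)) (home c)) (f (suc (t ℕ.+ t)) (second c)))

    brickΔ≥0 : ∀ t c → 0ℚ ≤ brick (Δ t) c
    brickΔ≥0 t c = +-mono-≤ (Δ≥0 t (home c)) (Δ≥0 t (second c))

    m-mono : ∀ t c → m t c ≤ m (suc t) c
    m-mono t c = combine (+-mono-≤ (brickΔ≥0 (t ℕ.+ t) c) (brickΔ≥0 (suc (t ℕ.+ t)) c))
      (trans (cong (_+ m t c) (sym (m-step t c))) (solve 2 (λ a b → (a :- b) :+ b := (con 0ℚ :+ con 0ℚ) :+ a) refl (m (suc t) c) (m t c)))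

    m-slow : ∀ t N → ∑ (window N) (λ u → spread (m (suc t)) u - spread (m t) u) ≤ σ + σ
    m-slow t N = begin
      ∑ (window N) (λ u → spread (m (suc t)) u - spread (m t) u)
        ≡⟨ ∑-cong (window N) (λ {u} _ → split u) ⟩
      ∑ (window N) (λ u → spread (brick (Δ (t ℕ.+ t))) u + spread (brick (Δ (suc (t ℕ.+ t)))) u)
        ≡⟨ ∑-+ (window N) (spread (brick (Δ (t ℕ.+ t)))) (spread (brick (Δ (suc (t ℕ.+ t))))) ⟩
      ∑ (window N) (spread (brick (Δ (t ℕ.+ t)))) + ∑ (window N) (spread (brick (Δ (suc (t ℕ.+ t)))))
        ≤⟨ +-mono-≤ (brick-sum (Δ (t ℕ.+ t)) (Δ≥0 (t ℕ.+ t)) (Δ-budget (t ℕ.+ t)) N)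
                    (brick-sum (Δ (suc (t ℕ.+ t))) (Δ≥0 (suc (t ℕ.+ t))) (Δ-budget (suc (t ℕ.+ t))) N) ⟩
      σ + σ ∎
      where
      open ≤-Reasoning
      split : ∀ u → spread (m (suc t)) u - spread (m t) u ≡ spread (brick (Δ (t ℕ.+ t))) u + spread (brick (Δ (suc (t ℕ.+ t)))) u
      split (h , c) = m-step t c
      split (v , c) = refl
      split (g , c) = refl

    initially : ∀ c → m 0 c ≡ 0ℚ
    initially c = refl

    open Fading m (σ + σ) initially m-mono m-slow using (safe)
    open Walk (faded f) using (e; reg; right-interior)

    r : ℕ → Cell
    r t = right (e t)

    σ≥0 : 0ℚ ≤ σ
    σ≥0 = ≤-trans (∑-nonNeg (box 0) (Δ≥0 0)) (Δ-budget 0 0)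

    f≥0 : ∀ t p → 0ℚ ≤ f t p
    f≥0 zero    p = ≤-refl
    f≥0 (suc t) p = ≤-trans (f≥0 t p) (f-mono t p)

    brick-step : ∀ t c → brick (f (suc t)) c ≤ brick (f t) c + σ
    brick-step t c = combine (brick-increment (Δ t) (Δ≥0 t) (Δ-budget t) c)
      (solve 5 (λ a b a′ b′ s → s :+ (a′ :+ b′) := ((a′ :- a) :+ (b′ :- b)) :+ ((a :+ b) :+ s)) refl
        (f t (home c)) (f t (second c)) (f (suc t) (home c)) (f (suc t) (second c)) σ)

    m-bound : ∀ t c → m (suc t) c ≤ m t c + (σ + σ)
    m-bound t c = begin
      brick (f (suc t ℕ.+ suc t)) c        ≡⟨ cong (λ s → brick (f (suc s)) c) (ℕₚ.+-suc t t) ⟩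
      brick (f (suc (suc (t ℕ.+ t)))) c    ≤⟨ brick-step (suc (t ℕ.+ t)) c ⟩
      brick (f (suc (t ℕ.+ t))) c + σ      ≤⟨ +-monoˡ-≤ σ (brick-step (t ℕ.+ t) c) ⟩
      (m t c + σ) + σ                      ≡⟨ +-assoc (m t c) σ σ ⟩
      m t c + (σ + σ)                      ∎
      where open ≤-Reasoning

    square-≤ : ∀ t c {p} → p ≡ home c ⊎ p ≡ second c → f t p ≤ brick (f t) c
    square-≤ t c (inj₁ refl) = ≤-trans (≤-reflexive (sym (+-identityʳ (f t (home c))))) (+-monoʳ-≤ (f t (home c)) (f≥0 t (second c)))
    square-≤ t c (inj₂ refl) = ≤-trans (≤-reflexive (sym (+-identityˡ (f t (second c))))) (+-monoˡ-≤ (f t (second c)) (f≥0 t (home c)))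

    next-light : ∀ t → m t (r (suc t)) ≤ ½
    next-light = safe small

    -- A cell is chosen from the weight of two turns before arrival, hence the extra `σ + σ`.
    arrival-light : ∀ t → m t (r t) ≤ ½ + (σ + σ)
    arrival-light zero    = ≤-trans (from-yes (0ℚ ≤? ½)) (≤-trans (≤-reflexive (sym (+-identityʳ ½))) (+-monoʳ-≤ ½ (+-mono-≤ σ≥0 σ≥0)))
    arrival-light (suc t) = ≤-trans (m-bound t (r (suc t))) (+-monoˡ-≤ (σ + σ) (next-light t))

    below-1 : (½ + (σ + σ)) + σ < 1ℚ
    -- 60 times the left side is `30 + 180 σ`; since `3600 σ ≤ 1` and 3420 is 3600 minus 180, this
    -- is at most 31.
    below-1 = *-cancelˡ-<-nonNeg (fromℕ 60) (≤-<-trans (combine (+-mono-≤ small (*-nonNeg (0≤fromℕ 3420) σ≥0))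
      (solve 1 (λ s → (con 1ℚ :+ con (fromℕ 3420) :* s) :+ con (fromℕ 60) :* ((con ½ :+ (s :+ s)) :+ s)
                      := (con (fromℕ 25) :* (con (fromℕ 72) :* (s :+ s)) :+ con 0ℚ) :+ con (fromℕ 31)) refl σ))
      (from-yes (fromℕ 31 <? fromℕ 60 * 1ℚ)))

    -- The intermediate square lies in the brick being left or in the one being entered, and the
    -- devil has had one more turn.
    middle-safe : ∀ t → f (suc (t ℕ.+ t)) (middle (reg (suc t)) (e t)) < 1ℚ
    middle-safe t with middle-on (reg (suc t)) (e t) (right-interior t)
    ... | _ , _ , c , which , on = ≤-<-trans (square-≤ (suc (t ℕ.+ t)) c on)
          (≤-<-trans (≤-trans (brick-step (t ℕ.+ t) c) (+-monoˡ-≤ σ (light which))) below-1)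
      where
      light : c ≡ r t ⊎ c ≡ r (suc t) → m t c ≤ ½ + (σ + σ)
      light (inj₁ eq) = subst (λ c → m t c ≤ ½ + (σ + σ)) (sym eq) (arrival-light t)
      light (inj₂ eq) = subst (λ c → m t c ≤ ½ + (σ + σ)) (sym eq) (≤-trans (next-light t)
        (≤-trans (≤-reflexive (sym (+-identityʳ ½))) (+-monoʳ-≤ ½ (+-mono-≤ σ≥0 σ≥0))))

    home-safe : ∀ t → f (suc t ℕ.+ suc t) (home (r (suc t))) < 1ℚ
    home-safe t = ≤-<-trans (square-≤ (suc t ℕ.+ suc t) (r (suc t)) (inj₁ refl))
      (≤-<-trans (≤-trans (arrival-light (suc t)) (≤-trans (≤-reflexive (sym (+-identityʳ (½ + (σ + σ))))) (+-monoʳ-≤ (½ + (σ + σ)) σ≥0))) below-1)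

    turn-safe : ∀ t n → dist (trajectory f t n) (trajectory f t (suc n)) ℕ.≤ 1 × f (t ℕ.+ t ℕ.+ suc n) (trajectory f t (suc n)) < 1ℚ
    turn-safe t zero = proj₁ (middle-on (reg (suc t)) (e t) (right-interior t)) ,
      subst (λ k → f k (middle (reg (suc t)) (e t)) < 1ℚ) (ℕₚ.+-comm 1 (t ℕ.+ t)) (middle-safe t)
    turn-safe t (suc zero) = proj₁ (proj₂ (middle-on (reg (suc t)) (e t) (right-interior t))) ,
      subst (λ k → f k (home (r (suc t))) < 1ℚ) (shift t) (home-safe t)
      where
      shift : ∀ t → suc t ℕ.+ suc t ≡ t ℕ.+ t ℕ.+ 2
      shift = solve-∀
    turn-safe t (suc (suc n)) = proj₁ (turn-safe (suc t) n) ,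
      subst (λ k → f k (trajectory f (suc t) (suc n)) < 1ℚ) (shift t n) (proj₂ (turn-safe (suc t) n))
      where
      shift : ∀ t n → suc t ℕ.+ suc t ℕ.+ suc n ≡ t ℕ.+ t ℕ.+ suc (suc (suc n))
      shift = solve-∀

  strategy-wins : Wins strategy μ
  strategy-wins = refl , λ n →
    subst₂ (λ p q → dist p q ℕ.≤ 1) (sym (position-strategy μ n)) (sym (position-strategy μ (suc n))) (proj₁ (turn-safe 0 n)) ,
    subst (λ p → μ (suc n) p < 1ℚ) (sym (position-strategy μ (suc n))) (proj₂ (turn-safe 0 n))

0<threshold : 0ℚ < threshold
0<threshold = subst (_< threshold) (*-zeroˡ (inv 59)) (*-monoˡ-<-pos (inv 59) {{positive (0<inv 59)}} (0<inv 59))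

theorem1p2 : Σ ℚ (λ σ₀ → (0ℚ < σ₀) × ((σ : ℚ) → 0ℚ < σ → σ ≤ σ₀ →
    Σ AngelStrategy (λ A → (μ : ℕ → Weight) → DevilPlay σ μ → Wins A μ)))
theorem1p2 = threshold , 0<threshold , λ σ _ σ≤threshold → strategy , λ μ devil → strategy-wins (small-budget σ≤threshold) devil
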